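{- Let $\lambda$ be a partition and $n\ge \ell(\lambda)$. Then $$ g_{\lambda}(x_1, \ldots, x_n) = \frac{\det\left[h_{\lambda_i + n - i}(1^{i-1}, x_j) \right]_{1 \le i,j \le n}}{\prod_{1\le i < j\le n} (x_i - x_j)}. $$
   Context: $\ell(\lambda)$ is the number of nonzero parts of $\lambda$, with $\lambda_i=0$ for $i>\ell(\lambda)$. A reverse plane partition (RPP) of shape $\lambda$ is a filling of the Young diagram of $\lambda$ (English notation) by positive integers weakly increasing along rows left to right and columns top to bottom; $g_{\lambda}(x_1,\ldots,x_n)=\sum_T\prod_{i=1}^n x_i^{c_i(T)}$ summed over RPPs $T$ of shape $\lambda$ with entries in $\{1,\ldots,n\}$, where $c_i(T)$ is the number of columns of $T$ containing $i$. $h_k(1^{i-1},x_j)$ is the complete homogeneous symmetric polynomial of degree $k$ in the $i$ variables consisting of $i-1$ copies of $1$ and the variable $x_j$. -}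

module Defs where

open import Level using (Level)
open import Data.Bool using (Bool; true; false; _∧_; T?)
open import Data.Nat using (ℕ; zero; suc; _∸_; _⊔_)
import Data.Nat as ℕ
open import Data.Nat using (_≤ᵇ_)
open import Data.Fin using (Fin; toℕ; punchIn) renaming (zero to fzero; suc to fsuc)
open import Data.List using (List; []; _∷_; [_]; map; foldr; concatMap; filter; allFin; upTo; replicate; _∷ʳ_; length)
open import Data.Bool.ListAction using (any)
open import Data.Vec using (Vec; []; _∷_; toList)
open import Data.Maybe using (Maybe; just; nothing)
open import Data.Product using (_×_; _,_)
open import Data.Unit using (⊤; tt)
open import Algebra.Bundles using (CommutativeRing)

-- Partitions: a partition λ with ℓ(λ) ≤ n is represented by its first
-- n parts (λ₁,…,λₙ), padded with zeros, required weakly decreasing.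

IsPartition : {n : ℕ} → Vec ℕ n → Set
IsPartition [] = ⊤
IsPartition (a ∷ []) = ⊤
IsPartition (a ∷ b ∷ as) = (b ℕ.≤ a) × IsPartition (b ∷ as)

-- Fillings of a Young diagram (English notation) with entries in
-- Fin n (entry k stands for the integer k+1 ∈ {1,…,n}).
-- A filling of shape (k₁,k₂,…) is a list of rows, row r of length k_r.

Rows : ℕ → List ℕ → Set
Rows n [] = ⊤
Rows n (k ∷ ks) = Vec (Fin n) k × Rows n ks

allVecs : (n k : ℕ) → List (Vec (Fin n) k)
allVecs n zero = [ [] ]
allVecs n (suc k) = concatMap (λ a → map (a ∷_) (allVecs n k)) (allFin n)

allRows : (n : ℕ) (ks : List ℕ) → List (Rows n ks)
allRows n [] = [ tt ]
allRows n (k ∷ ks) =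
  concatMap (λ r → map (r ,_) (allRows n ks)) (allVecs n k)

_≤F_ : {n : ℕ} → Fin n → Fin n → Bool
a ≤F b = toℕ a ≤ᵇ toℕ b

rowOK : {n k : ℕ} → Vec (Fin n) k → Bool
rowOK [] = true
rowOK (a ∷ []) = true
rowOK (a ∷ b ∷ as) = (a ≤F b) ∧ rowOK (b ∷ as)

colOK : {n k k' : ℕ} → Vec (Fin n) k → Vec (Fin n) k' → Bool
colOK (a ∷ as) (b ∷ bs) = (a ≤F b) ∧ colOK as bs
colOK _ _ = true

isRPP : {n : ℕ} (ks : List ℕ) → Rows n ks → Bool
isRPP [] tt = true
isRPP (k ∷ []) (r , tt) = rowOK r
isRPP (k ∷ k' ∷ ks) (r , (r' , rs)) =
  rowOK r ∧ colOK r r' ∧ isRPP (k' ∷ ks) (r' , rs)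

lookupV : {A : Set} {k : ℕ} → Vec A k → ℕ → Maybe A
lookupV [] _ = nothing
lookupV (a ∷ as) zero = just a
lookupV (a ∷ as) (suc j) = lookupV as j

column : {n : ℕ} (ks : List ℕ) → Rows n ks → ℕ → List (Fin n)
column [] tt j = []
column (k ∷ ks) (r , rs) j with lookupV r j
... | just a  = a ∷ column ks rs j
... | nothing = column ks rs j

_==F_ : {n : ℕ} → Fin n → Fin n → Bool
a ==F b = (a ≤F b) ∧ (b ≤F a)

colCount : {n : ℕ} (ks : List ℕ) → Rows n ks → Fin n → ℕ
colCount ks T a =
  length (filter (λ j → T? (any (a ==F_) (column ks T j)))
                 (upTo (foldr _⊔_ 0 ks)))

module _ {c ℓ : Level} (R : CommutativeRing c ℓ) where
  open CommutativeRing R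

  sumR : List Carrier → Carrier
  sumR = foldr _+_ 0#

  prodR : List Carrier → Carrier
  prodR = foldr _*_ 1#

  pow : Carrier → ℕ → Carrier
  pow y zero = 1#
  pow y (suc m) = y * pow y m

  gPoly : {n : ℕ} → Vec ℕ n → (Fin n → Carrier) → Carrier
  gPoly {n} lam x =
    sumR (map (λ T → prodR (map (λ a → pow (x a) (colCount (toList lam) T a))
                                (allFin n)))
              (filter (λ T → T? (isRPP (toList lam) T))
                      (allRows n (toList lam))))

  hComplete : ℕ → List Carrier → Carrier
  hComplete zero [] = 1#
  hComplete (suc k) [] = 0#
  hComplete k (y ∷ ys) =
    sumR (map (λ m → pow y m * hComplete (k ∸ m) ys) (upTo (suc k)))

  det : (n : ℕ) → (Fin n → Fin n → Carrier) → Carrier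
  det zero M = 1#
  det (suc n) M = go (allFin (suc n)) true
    where
    term : Fin (suc n) → Carrier
    term j = M fzero j * det n (λ i k → M (fsuc i) (punchIn j k))
    go : List (Fin (suc n)) → Bool → Carrier
    go [] s = 0#
    go (j ∷ js) true  = term j + go js false
    go (j ∷ js) false = (- term j) + go js true

  vandermonde : {n : ℕ} → (Fin n → Carrier) → Carrier
  vandermonde {n} x =
    prodR (concatMap (λ i → map (λ j → x i - x j)
                               (filter (λ j → toℕ i ℕ.<? toℕ j) (allFin n)))
                     (allFin n))

  -- entry (i,j) (0-based) of the numerator matrix:
  -- h_{λ_i + n - i}(1^{i-1}, x_j) in 1-based indexing
  numMatrix : {n : ℕ} → Vec ℕ n → (Fin n → Carrier) → Fin n → Fin n → Carrier
  numMatrix {n} lam x i j =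
    hComplete (Data.Vec.lookup lam i ℕ.+ (n ∸ suc (toℕ i)))
              (replicate (toℕ i) 1# ∷ʳ x j)
    where import Data.Vec

{-# OPTIONS --safe #-}

-- Let t be the last variable. Splitting each row of a reverse plane partition into the entries below the
-- largest letter and the copies of it gives the branching rule g_λ(x, t) = ∑_μ t^{c(λ/μ)} g_μ(x), summed over
-- all partitions μ ⊆ λ, where c(λ/μ) is the number of nonempty columns of λ/μ.
--
-- Multiplying by the Vandermonde product turns g_λ(x₁,…,x_N) into the determinant whose (i, j) entry is the
-- coefficient of z^{λᵢ+n−i} in (1−z)^{−(i−1)} ∏_{l≤N} (1−x_l z)^{−1} ∏_{l≠j} (1−x_l z). Adding a variable t
-- divides every series by 1−tz, so expanding the rows writes the new determinant as a sum over all
-- integer vectors below λ. Consecutive rows satisfy v_{q+1} = v_q + u_{q+1}, so alternation in adjacent rows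
-- collapses this sum to the sum over partitions in the branching rule. For N = 0 only the
-- empty shape survives, with determinant ∏_{i<j} (xᵢ − xⱼ); for N = n the product telescopes to 1/(1−xⱼz),
-- whose coefficients are those of the numerator matrix.
module Submission where

open import Defs
open import Level using (Level) renaming (_⊔_ to _⊔ˡ_)
open import Data.Bool using (Bool; true; false; if_then_else_; _∧_; _∨_; T; T?)
open import Data.Bool.ListAction using (any)
open import Data.Bool.Properties using (∧-zeroʳ; ∨-identityʳ)
open import Data.Nat as ℕ using (ℕ; zero; suc; _∸_; _⊔_; _⊓_; _≤_; _<_; z≤n; s≤s)
import Data.Nat.Properties as ℕₚ
open import Data.Fin using (Fin; toℕ; punchIn; fromℕ; inject₁) renaming (zero to fzero; suc to fsuc)
import Data.Fin.Properties as Finₚ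
import Data.List as List
import Data.List.Properties as Listₚ
open import Data.List.Relation.Unary.All as All using (All)
open import Data.List.Relation.Unary.Linked as Linked using (Linked)
open import Data.List.Relation.Unary.Linked.Properties using (Linked⇒All)
open import Data.Maybe using (Maybe; just; nothing)
open import Data.Vec using (Vec; []; _∷_; map; tabulate; lookup; toList; replicate)
open import Data.Vec.Properties using (tabulate-∘)
open import Data.Vec.Relation.Binary.Pointwise.Inductive using (Pointwise; []; _∷_)
open import Data.Product using (_×_; _,_; proj₁; proj₂)
open import Data.Unit using (tt)
import Data.Unit.Polymorphic as Poly
open import Function using (_∘_; case_of_)
open import Relation.Nullary using (does; yes; no; contradiction)
open import Relation.Unary using (Decidable)
open import Algebra.Bundles using (CommutativeRing; CommutativeMonoid)
import Algebra.Properties.CommutativeSemigroup as CommutativeSemigroupProperties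
import Relation.Binary.PropositionalEquality as ≡
open ≡ using (_≡_)

-- Over an arbitrary commutative ring the Vandermonde product need not be cancellable, so the
-- identity is proved multiplied out, with a determinant that makes sense for every intermediate
-- number of letters. Hence two families are kept apart: y, the letters allowed in the fillings, and
-- x, the columns of the determinant, whose size n never changes. They are identified only at the
-- end. The factors ∏_{l≠j} (1-x_l z) have degree n-1, just low enough for the first row to vanish
-- on nonempty shapes when there are no letters.
--
-- The obstacle is that the weight counts columns, not cells: where μᵢ < λᵢ₊₁ a column of λ/μ may
-- run through several rows but carries a single t, so the sum does not factor over the rows. In
-- that range the weight of row i no longer depends on μᵢ, and the pairs (μᵢ, μᵢ₊₁) fill a triangle.
-- The extra factor 1/(1-z) from each row to the next makes this triangle telescope, and what
-- remains is repaired by row operations on two adjacent rows.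

-- Here k is the position of j′ once j is deleted, and k′ that of j once j′ is deleted; both sides
-- enumerate the columns other than j and j′ in increasing order. This identifies the double minors
-- of a two-row expansion.
punchIn-swap : ∀ {n} (j : Fin (suc (suc n))) (k : Fin (suc n)) {j′ k′} →
  punchIn j k ≡ j′ → punchIn j′ k′ ≡ j →
  ∀ l → punchIn j (punchIn k l) ≡ punchIn j′ (punchIn k′ l)
punchIn-swap fzero k {k′ = fzero} ≡.refl _ l = ≡.refl
punchIn-swap fzero k {k′ = fsuc k′} ≡.refl () l
punchIn-swap (fsuc j) fzero ≡.refl ≡.refl l = ≡.refl
punchIn-swap {suc n} (fsuc j) (fsuc k) {k′ = fzero} ≡.refl () l
punchIn-swap {suc n} (fsuc j) (fsuc k) {k′ = fsuc k′} ≡.refl e fzero = ≡.refl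
punchIn-swap {suc n} (fsuc j) (fsuc k) {k′ = fsuc k′} ≡.refl e (fsuc l) =
  ≡.cong fsuc (punchIn-swap j k ≡.refl (Finₚ.suc-injective e) l)

-- Partition shapes and the columns of their fillings

firstPart : ∀ {m} → Vec ℕ m → ℕ
firstPart [] = 0
firstPart (k ∷ _) = k

uncons-partition : ∀ {m k} (ks : Vec ℕ m) → IsPartition (k ∷ ks) → firstPart ks ≤ k × IsPartition ks
uncons-partition [] _ = z≤n , tt
uncons-partition (k′ ∷ ks) p = p

cons-partition : ∀ {m k} (ks : Vec ℕ m) → firstPart ks ≤ k → IsPartition ks → IsPartition (k ∷ ks)
cons-partition [] _ _ = tt
cons-partition (k′ ∷ ks) le p = le , p

partition-zero : ∀ {n} (ks : Vec ℕ n) → IsPartition (0 ∷ ks) → ks ≡ replicate n 0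
partition-zero [] P = ≡.refl
partition-zero (zero ∷ ks) (_ , P) = ≡.cong (0 ∷_) (partition-zero ks P)

∧-true : ∀ {a b} → a ∧ b ≡ true → a ≡ true × b ≡ true
∧-true {true} e = ≡.refl , e

module _ {N : ℕ} where

  ≤F⇒≤ : ∀ (a b : Fin N) → (a ≤F b) ≡ true → toℕ a ≤ toℕ b
  ≤F⇒≤ a b e = ℕₚ.≤ᵇ⇒≤ (toℕ a) (toℕ b) (≡.subst T (≡.sym e) tt)

  ≤⇒≤F : ∀ (a b : Fin N) → toℕ a ≤ toℕ b → (a ≤F b) ≡ true
  ≤⇒≤F a b le with a ≤F b | ℕₚ.≤⇒≤ᵇ le
  ... | true | _ = ≡.refl

  <⇒≰F : ∀ (a b : Fin N) → toℕ a < toℕ b → (b ≤F a) ≡ false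
  <⇒≰F a b lt with b ≤F a in e
  ... | true = contradiction (≤F⇒≤ b a e) (ℕₚ.<⇒≱ lt)
  ... | false = ≡.refl

  ==F⇒≡ : ∀ (a b : Fin N) → (a ==F b) ≡ true → a ≡ b
  ==F⇒≡ a b e = Finₚ.toℕ-injective
    (ℕₚ.≤-antisym (≤F⇒≤ a b (proj₁ (∧-true e))) (≤F⇒≤ b a (proj₂ (∧-true {a ≤F b} e))))

  ==F-refl : ∀ (a : Fin N) → (a ==F a) ≡ true
  ==F-refl a rewrite ≤⇒≤F a a ℕₚ.≤-refl = ≡.refl

  <⇒≠F : ∀ (a b : Fin N) → toℕ a < toℕ b → (a ==F b) ≡ false
  <⇒≠F a b lt rewrite ≤⇒≤F a b (ℕₚ.<⇒≤ lt) = <⇒≰F a b lt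

  ≤∧≠F⇒< : ∀ (a b : Fin N) → toℕ a ≤ toℕ b → (a ==F b) ≡ false → toℕ a < toℕ b
  ≤∧≠F⇒< a b le ne = ℕₚ.≤∧≢⇒< le λ e →
    case ≡.trans (≡.sym ne) (≡.subst (λ c → (a ==F c) ≡ true) (Finₚ.toℕ-injective e) (==F-refl a)) of λ ()

  any-false : ∀ (p : Fin N → Bool) {xs} → All (λ i → p i ≡ false) xs → any p xs ≡ false
  any-false p All.[] = ≡.refl
  any-false p (e All.∷ es) rewrite e = any-false p es

  lookupV-shorter : ∀ {k k′} (r : Vec (Fin N) k) (r′ : Vec (Fin N) k′) → k′ ≤ k →
    ∀ j → lookupV r j ≡ nothing → lookupV r′ j ≡ nothing
  lookupV-shorter r [] _ j e = ≡.refl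
  lookupV-shorter (a ∷ r) (b ∷ r′) (s≤s le) (suc j) e = lookupV-shorter r r′ le j e

  lookupV-colOK : ∀ {k k′} (r : Vec (Fin N) k) (r′ : Vec (Fin N) k′) → colOK r r′ ≡ true →
    ∀ j {a b} → lookupV r j ≡ just a → lookupV r′ j ≡ just b → toℕ a ≤ toℕ b
  lookupV-colOK (a ∷ r) (b ∷ r′) ok zero ≡.refl ≡.refl = ≤F⇒≤ a b (proj₁ (∧-true ok))
  lookupV-colOK (a ∷ r) (b ∷ r′) ok (suc j) e e′ =
    lookupV-colOK r r′ (proj₂ (∧-true {a ≤F b} ok)) j e e′

  topEntry : ∀ {m} (ks : Vec ℕ m) → Rows N (toList ks) → ℕ → Maybe (Fin N)
  topEntry [] tt j = nothing
  topEntry (k ∷ ks) (r , rs) j = lookupV r j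

  topEntry-nothing : ∀ {m k} (r : Vec (Fin N) k) (ks : Vec ℕ m) rs → IsPartition (k ∷ ks) →
    ∀ j → lookupV r j ≡ nothing → topEntry ks rs j ≡ nothing
  topEntry-nothing r [] tt P j e = ≡.refl
  topEntry-nothing r (k′ ∷ ks) (r′ , rs) P j e = lookupV-shorter r r′ (proj₁ P) j e

  -- `column` silently skips rows that do not reach column j. In a partition the rows below are no
  -- longer, so a gap is final and neighbours in the list come from adjacent rows.
  column-nothing : ∀ {m} (ks : Vec ℕ m) rs → IsPartition ks →
    ∀ j → topEntry ks rs j ≡ nothing → column (toList ks) rs j ≡ List.[]
  column-nothing [] tt P j e = ≡.refl
  column-nothing (k ∷ ks) (r , rs) P j e with lookupV r j in e′
  ... | nothing = column-nothing ks rs (proj₂ (uncons-partition ks P)) j (topEntry-nothing r ks rs P j e′)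

  column-just : ∀ {m} (ks : Vec ℕ m) rs j {b} → topEntry ks rs j ≡ just b →
    List.head (column (toList ks) rs j) ≡ just b
  column-just (k ∷ ks) (r , rs) j e with lookupV r j
  ... | just b = e

  Ascending : List.List (Fin N) → Set
  Ascending = Linked (λ a b → toℕ a ≤ toℕ b)

  isRPP-tail : ∀ {m k} (r : Vec (Fin N) k) (ks : Vec ℕ m) rs →
    isRPP (toList (k ∷ ks)) (r , rs) ≡ true → isRPP (toList ks) rs ≡ true
  isRPP-tail r [] tt ok = ≡.refl
  isRPP-tail r (k′ ∷ ks) (r′ , rs) ok = proj₂ (∧-true {colOK r r′} (proj₂ (∧-true {rowOK r} ok)))

  column-below : ∀ {m k} (r : Vec (Fin N) k) (ks : Vec ℕ m) rs →
    isRPP (toList (k ∷ ks)) (r , rs) ≡ true →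
    ∀ j {a b} → lookupV r j ≡ just a → topEntry ks rs j ≡ just b → toℕ a ≤ toℕ b
  column-below r (k′ ∷ ks) (r′ , rs) ok =
    lookupV-colOK r r′ (proj₁ (∧-true (proj₂ (∧-true {rowOK r} ok))))

  column-ascending : ∀ {m} (ks : Vec ℕ m) rs → IsPartition ks → isRPP (toList ks) rs ≡ true →
    ∀ j → Ascending (column (toList ks) rs j)
  column-ascending [] tt P ok j = Linked.[]
  column-ascending (k ∷ ks) (r , rs) P ok j
    with lookupV r j in e | column-ascending ks rs (proj₂ (uncons-partition ks P)) (isRPP-tail r ks rs ok) j
  ... | nothing | asc = asc
  ... | just a | asc with topEntry ks rs j in e′
  ...   | nothing rewrite column-nothing ks rs (proj₂ (uncons-partition ks P)) j e′ = Linked.[-]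
  ...   | just b with column (toList ks) rs j | column-just ks rs j e′
  ...     | _ List.∷ _ | ≡.refl = column-below r ks rs ok j e e′ Linked.∷ asc

-- `padMax k s` fills s up to length k with copies of the largest letter; its value is only
-- meaningful when s has length at most k.
padMax : ∀ {N m} k → Vec (Fin N) m → Vec (Fin (suc N)) k
padMax zero s = []
padMax {N} (suc k) [] = fromℕ N ∷ padMax k []
padMax (suc k) (a ∷ s) = inject₁ a ∷ padMax k s

headOK : ∀ {N k} → Fin N → Vec (Fin N) k → Bool
headOK a [] = true
headOK a (b ∷ _) = a ≤F b

rowOK-∷ : ∀ {N k} a (s : Vec (Fin N) k) → rowOK (a ∷ s) ≡ headOK a s ∧ rowOK s
rowOK-∷ a [] = ≡.refl
rowOK-∷ a (b ∷ s) = ≡.refl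

module _ {N : ℕ} where

  inject₁-≤F : ∀ (a b : Fin N) → (inject₁ a ≤F inject₁ b) ≡ (a ≤F b)
  inject₁-≤F a b = ≡.cong₂ ℕ._≤ᵇ_ (Finₚ.toℕ-inject₁ a) (Finₚ.toℕ-inject₁ b)

  inject₁<fromℕ : ∀ (a : Fin N) → toℕ (inject₁ a) < toℕ (fromℕ N)
  inject₁<fromℕ a = ≡.subst₂ _<_ (≡.sym (Finₚ.toℕ-inject₁ a)) (≡.sym (Finₚ.toℕ-fromℕ N)) (Finₚ.toℕ<n a)

  headOK-padMax-inject₁ : ∀ {m} k a (s : Vec (Fin N) m) → m ≤ k →
    headOK (inject₁ a) (padMax k s) ≡ headOK a s
  headOK-padMax-inject₁ zero a [] _ = ≡.refl
  headOK-padMax-inject₁ (suc k) a [] _ = ≤⇒≤F (inject₁ a) (fromℕ N) (ℕₚ.<⇒≤ (inject₁<fromℕ a))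
  headOK-padMax-inject₁ (suc k) a (b ∷ s) _ = inject₁-≤F a b

  colOK-[] : ∀ {m} (s : Vec (Fin N) m) → colOK {k' = 0} s [] ≡ true
  colOK-[] [] = ≡.refl
  colOK-[] (a ∷ s) = ≡.refl

  -- With m′ ≤ m no small letter stands below a largest one; the other pairs involving `fromℕ N` are
  -- in order automatically.
  colOK-padMax : ∀ {m m′} k k′ (s : Vec (Fin N) m) (s′ : Vec (Fin N) m′) → m ≤ k → m′ ≤ k′ → m′ ≤ m →
    colOK (padMax k s) (padMax k′ s′) ≡ colOK s s′
  colOK-padMax zero k′ [] [] _ _ _ = ≡.refl
  colOK-padMax (suc k) zero [] [] _ _ _ = ≡.refl
  colOK-padMax (suc k) (suc k′) [] [] _ _ _
    rewrite ≤⇒≤F (fromℕ N) (fromℕ N) ℕₚ.≤-refl = colOK-padMax k k′ [] [] z≤n z≤n z≤n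
  colOK-padMax (suc k) zero (a ∷ s) [] _ _ _ = ≡.refl
  colOK-padMax (suc k) (suc k′) (a ∷ s) [] (s≤s le) _ _
    rewrite ≤⇒≤F (inject₁ a) (fromℕ N) (ℕₚ.<⇒≤ (inject₁<fromℕ a)) =
      ≡.trans (colOK-padMax k k′ s [] le z≤n z≤n) (colOK-[] s)
  colOK-padMax (suc k) (suc k′) (a ∷ s) (b ∷ s′) (s≤s le) (s≤s le′) (s≤s le″) =
    ≡.cong₂ _∧_ (inject₁-≤F a b) (colOK-padMax k k′ s s′ le le′ le″)

  -- In the column at index m the upper row already has the largest letter while the lower row still
  -- has a small one.
  colOK-padMax-false : ∀ {m m′} k k′ (s : Vec (Fin N) m) (s′ : Vec (Fin N) m′) → m < m′ → m′ ≤ k′ → k′ ≤ k →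
    colOK (padMax k s) (padMax k′ s′) ≡ false
  colOK-padMax-false (suc k) (suc k′) [] (b ∷ s′) _ _ _
    rewrite <⇒≰F (inject₁ b) (fromℕ N) (inject₁<fromℕ b) = ≡.refl
  colOK-padMax-false (suc k) (suc k′) (a ∷ s) (b ∷ s′) (s≤s lt) (s≤s le) (s≤s le′)
    rewrite colOK-padMax-false k k′ s s′ lt le le′ = ∧-zeroʳ _

-- Finite folds in a commutative monoid, used for both sums and products

module ListFold {c ℓ : Level} (M : CommutativeMonoid c ℓ) where
  open CommutativeMonoid M
  open CommutativeSemigroupProperties commutativeSemigroup using (interchange)

  fold : List.List Carrier → Carrier
  fold = List.foldr _∙_ ε

  module _ {a} {A : Set a} where

    fold-cong : ∀ {f g : A → Carrier} → (∀ i → f i ≈ g i) →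
      ∀ xs → fold (List.map f xs) ≈ fold (List.map g xs)
    fold-cong e List.[] = refl
    fold-cong e (i List.∷ xs) = ∙-cong (e i) (fold-cong e xs)

    fold-++ : ∀ (f : A → Carrier) xs ys →
      fold (List.map f (xs List.++ ys)) ≈ fold (List.map f xs) ∙ fold (List.map f ys)
    fold-++ f List.[] ys = sym (identityˡ _)
    fold-++ f (i List.∷ xs) ys = trans (∙-congˡ (fold-++ f xs ys)) (sym (assoc _ _ _))

    fold-ε : ∀ xs → fold (List.map (λ (_ : A) → ε) xs) ≈ ε
    fold-ε List.[] = refl
    fold-ε (_ List.∷ xs) = trans (identityˡ _) (fold-ε xs)

    fold-∙ : ∀ (f g : A → Carrier) xs →
      fold (List.map (λ i → f i ∙ g i) xs) ≈ fold (List.map f xs) ∙ fold (List.map g xs)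
    fold-∙ f g List.[] = sym (identityˡ _)
    fold-∙ f g (i List.∷ xs) = trans (∙-congˡ (fold-∙ f g xs))
      (interchange (f i) (g i) (fold (List.map f xs)) (fold (List.map g xs)))

    fold-filter : ∀ {p} {P : A → Set p} (P? : Decidable P) (f : A → Carrier) xs →
      fold (List.map f (List.filter P? xs)) ≈ fold (List.map (λ i → if does (P? i) then f i else ε) xs)
    fold-filter P? f List.[] = refl
    fold-filter P? f (i List.∷ xs) with does (P? i)
    ... | true = ∙-congˡ (fold-filter P? f xs)
    ... | false = trans (fold-filter P? f xs) (sym (identityˡ _))

  fold-map : ∀ {a b} {A : Set a} {B : Set b} (f : B → Carrier) (g : A → B) xs →
    fold (List.map f (List.map g xs)) ≈ fold (List.map (f ∘ g) xs)
  fold-map f g List.[] = refl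
  fold-map f g (i List.∷ xs) = ∙-congˡ (fold-map f g xs)

  fold-concatMap : ∀ {a b} {A : Set a} {B : Set b} (f : B → Carrier) (g : A → List.List B) xs →
    fold (List.map f (List.concatMap g xs)) ≈ fold (List.map (λ i → fold (List.map f (g i))) xs)
  fold-concatMap f g List.[] = refl
  fold-concatMap f g (i List.∷ xs) = trans (fold-++ f (g i) _) (∙-congˡ (fold-concatMap f g xs))

  fold-upTo-suc : ∀ (f : ℕ → Carrier) n →
    fold (List.map f (List.upTo (suc n))) ≈ f 0 ∙ fold (List.map (f ∘ suc) (List.upTo n))
  fold-upTo-suc f n = ∙-congˡ (reflexive (≡.cong fold
    (≡.trans (Listₚ.map-applyUpTo suc f n) (≡.sym (Listₚ.map-upTo (f ∘ suc) n)))))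

  fold-comm : ∀ {a b} {A : Set a} {B : Set b} (f : A → B → Carrier) xs ys →
    fold (List.map (λ i → fold (List.map (f i) ys)) xs) ≈
    fold (List.map (λ j → fold (List.map (λ i → f i j) xs)) ys)
  fold-comm f List.[] ys = sym (fold-ε ys)
  fold-comm f (i List.∷ xs) ys = trans (∙-congˡ (fold-comm f xs ys)) (sym (fold-∙ (f i) _ ys))

  foldFin : ∀ n → (Fin n → Carrier) → Carrier
  foldFin zero f = ε
  foldFin (suc n) f = f fzero ∙ foldFin n (f ∘ fsuc)

  foldFin-cong : ∀ n {f g : Fin n → Carrier} → (∀ i → f i ≈ g i) → foldFin n f ≈ foldFin n g
  foldFin-cong zero e = refl
  foldFin-cong (suc n) e = ∙-cong (e fzero) (foldFin-cong n (e ∘ fsuc))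

  foldFin-ε : ∀ n → foldFin n (λ _ → ε) ≈ ε
  foldFin-ε zero = refl
  foldFin-ε (suc n) = trans (identityˡ _) (foldFin-ε n)

  foldFin-last : ∀ n (f : Fin (suc n) → Carrier) →
    foldFin (suc n) f ≈ foldFin n (f ∘ inject₁) ∙ f (fromℕ n)
  foldFin-last zero f = comm _ _
  foldFin-last (suc n) f = trans (∙-congˡ (foldFin-last n (f ∘ fsuc))) (sym (assoc _ _ _))

  fold-tabulate : ∀ {a} {A : Set a} n (σ : Fin n → A) (f : A → Carrier) →
    fold (List.map f (List.tabulate σ)) ≈ foldFin n (f ∘ σ)
  fold-tabulate zero σ f = refl
  fold-tabulate (suc n) σ f = ∙-congˡ (fold-tabulate n (σ ∘ fsuc) f)

module DualGrothendieck {c ℓ : Level} (R : CommutativeRing c ℓ) where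
  open CommutativeRing R hiding (zero)
  open import Algebra.Properties.Ring ring using (-1*x≈-x)
  open import Algebra.Properties.Group +-group using (∙-cancelˡ; ⁻¹-involutive)
  open import Relation.Binary.Reasoning.Setoid setoid
  open import Algebra.Solver.Ring.NaturalCoefficients.Default commutativeSemiring
    using (solve; _:=_; _:+_; _:*_)
  module Sum = ListFold +-commutativeMonoid
  module Prod = ListFold *-commutativeMonoid

  -- Alternating multilinear functionals and the determinant

  private
    -1# : Carrier
    -1# = - 1#

  x+-1*x≈0 : ∀ a → a + -1# * a ≈ 0#
  x+-1*x≈0 a = trans (+-congˡ (-1*x≈-x a)) (-‿inverseʳ a)

  x≈x+y⇒y≈0 : ∀ {a b} → a ≈ a + b → b ≈ 0#
  x≈x+y⇒y≈0 {a} {b} e = ∙-cancelˡ a b 0# (trans (sym e) (sym (+-identityʳ a)))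

  -- The nested form f₀ - (f₁ - (f₂ - ...)) matches the recursion on `Fin`. Writing the sign as
  -- multiplication by `-1#` makes it an atom for the commutative semiring solver.
  altSum : ∀ n → (Fin n → Carrier) → Carrier
  altSum zero f = 0#
  altSum (suc n) f = f fzero + -1# * altSum n (f ∘ fsuc)

  altSum-cong : ∀ n {f g} → (∀ j → f j ≈ g j) → altSum n f ≈ altSum n g
  altSum-cong zero e = refl
  altSum-cong (suc n) e = +-cong (e fzero) (*-congˡ (altSum-cong n (e ∘ fsuc)))

  altSum-0 : ∀ n {f} → (∀ j → f j ≈ 0#) → altSum n f ≈ 0#
  altSum-0 zero e = refl
  altSum-0 (suc n) e =
    trans (+-cong (e fzero) (trans (*-congˡ (altSum-0 n (e ∘ fsuc))) (zeroʳ _))) (+-identityˡ _)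

  altSum-linear : ∀ n a (f g : Fin n → Carrier) →
    altSum n (λ j → f j + a * g j) ≈ altSum n f + a * altSum n g
  altSum-linear zero a f g = sym (trans (+-identityˡ _) (zeroʳ a))
  altSum-linear (suc n) a f g =
    trans (+-congˡ (*-congˡ (altSum-linear n a (f ∘ fsuc) (g ∘ fsuc))))
      (solve 6 (λ a f g s F G → (f :+ a :* g) :+ s :* (F :+ a :* G) :=
                                (f :+ s :* F) :+ a :* (g :+ s :* G)) refl
             a (f fzero) (g fzero) -1# (altSum n (f ∘ fsuc)) (altSum n (g ∘ fsuc)))

  *-distribˡ-altSum : ∀ n a (f : Fin n → Carrier) →
    a * altSum n f ≈ altSum n (λ j → a * f j)
  *-distribˡ-altSum zero a f = zeroʳ a
  *-distribˡ-altSum (suc n) a f =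
    trans (solve 4 (λ a f s F → a :* (f :+ s :* F) := a :* f :+ s :* (a :* F)) refl
                 a (f fzero) -1# (altSum n (f ∘ fsuc)))
          (+-congˡ (*-congˡ (*-distribˡ-altSum n a (f ∘ fsuc))))

  -- The index pairs (j , k) and (j′ , k′) delete the same two columns, in opposite order.
  altSum-symmetric≈0 : ∀ m (q : Fin (suc m) → Fin m → Carrier) →
    (∀ j k j′ k′ → punchIn j k ≡ j′ → punchIn j′ k′ ≡ j → q j k ≈ q j′ k′) →
    altSum (suc m) (λ j → altSum m (q j)) ≈ 0#
  altSum-symmetric≈0 zero q s = altSum-0 1 λ _ → refl
  altSum-symmetric≈0 (suc m) q s = begin
    altSum (suc m) (q fzero) + -1# * altSum (suc m) (λ j → q (fsuc j) fzero + -1# * inner j)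
      ≈⟨ +-cong (altSum-cong (suc m) (λ k → s fzero k (fsuc k) fzero ≡.refl ≡.refl))
                (*-congˡ (altSum-linear (suc m) -1# (λ j → q (fsuc j) fzero) inner)) ⟩
    first + -1# * (first + -1# * altSum (suc m) inner)
      ≈⟨ +-congˡ (*-congˡ (trans (+-congˡ (trans (*-congˡ rest≈0) (zeroʳ _))) (+-identityʳ _))) ⟩
    first + -1# * first
      ≈⟨ x+-1*x≈0 first ⟩
    0# ∎
    where
    inner = λ j → altSum m (λ k → q (fsuc j) (fsuc k))
    first = altSum (suc m) (λ j → q (fsuc j) fzero)
    rest≈0 : altSum (suc m) inner ≈ 0#
    rest≈0 = altSum-symmetric≈0 m (λ j k → q (fsuc j) (fsuc k))
      λ j k j′ k′ e e′ → s (fsuc j) (fsuc k) (fsuc j′) (fsuc k′) (≡.cong fsuc e) (≡.cong fsuc e′)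

  Row : ℕ → Set c
  Row w = Fin w → Carrier

  infix 4 _≋_
  _≋_ : ∀ {w} → Row w → Row w → Set ℓ
  v ≋ u = ∀ j → v j ≈ u j

  infixl 6 _+ʳ_
  _+ʳ_ : ∀ {w} → Row w → Row w → Row w
  (v +ʳ u) j = v j + u j

  infixl 7 _*ʳ_
  _*ʳ_ : ∀ {w} → Carrier → Row w → Row w
  (a *ʳ v) j = a * v j

  VanishesOnRepeat : ∀ {w} m → (Row w → Vec (Row w) m → Carrier) → Set (c ⊔ˡ ℓ)
  VanishesOnRepeat zero f = Poly.⊤
  VanishesOnRepeat (suc m) f = ∀ v rs → f v (v ∷ rs) ≈ 0#

  -- The conditions concern the head of the vector and recurse with the head fixed, so only adjacent
  -- repeats must vanish; that is all the row operations below need. The second condition of `cons`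
  -- is additivity and homogeneity in one.
  data Alternating {w} : ∀ m → (Vec (Row w) m → Carrier) → Set (c ⊔ˡ ℓ) where
    nil  : ∀ {f} → Alternating zero f
    cons : ∀ {m f} →
      (∀ {v u} → v ≋ u → ∀ rs → f (v ∷ rs) ≈ f (u ∷ rs)) →
      (∀ a v u rs → f ((v +ʳ a *ʳ u) ∷ rs) ≈ f (v ∷ rs) + a * f (u ∷ rs)) →
      VanishesOnRepeat m (λ v rs → f (v ∷ rs)) →
      (∀ v → Alternating m (λ rs → f (v ∷ rs))) →
      Alternating (suc m) f

  module _ {w : ℕ} where

    head-cong : ∀ {m} {f : Vec (Row w) (suc m) → Carrier} → Alternating (suc m) f →
      ∀ {v u} rs → v ≋ u → f (v ∷ rs) ≈ f (u ∷ rs)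
    head-cong (cons cg _ _ _) rs e = cg e rs

    linear : ∀ {m} {f : Vec (Row w) (suc m) → Carrier} → Alternating (suc m) f →
      ∀ a v u rs → f ((v +ʳ a *ʳ u) ∷ rs) ≈ f (v ∷ rs) + a * f (u ∷ rs)
    linear (cons _ ln _ _) = ln

    repeat≈0 : ∀ {m} {f : Vec (Row w) (suc (suc m)) → Carrier} → Alternating (suc (suc m)) f →
      ∀ v rs → f (v ∷ v ∷ rs) ≈ 0#
    repeat≈0 (cons _ _ rp _) = rp

    fix : ∀ {m} {f : Vec (Row w) (suc m) → Carrier} → Alternating (suc m) f →
      ∀ v → Alternating m (λ rs → f (v ∷ rs))
    fix (cons _ _ _ fx) = fx

    alternating-cong : ∀ {m} {f : Vec (Row w) m → Carrier} → Alternating m f →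
      ∀ {rs ss} → Pointwise _≋_ rs ss → f rs ≈ f ss
    alternating-cong A [] = refl
    alternating-cong A (_∷_ {x = v} {y = u} {xs = rs} e es) =
      trans (head-cong A rs e) (alternating-cong (fix A u) es)

    -- A zero row v equals v + 1·v, so linearity turns its value into a sum of itself with itself,
    -- and cancellation applies.
    head-zero : ∀ {m} {f : Vec (Row w) (suc m) → Carrier} → Alternating (suc m) f →
      ∀ {v} rs → (∀ j → v j ≈ 0#) → f (v ∷ rs) ≈ 0#
    head-zero {f = f} A {v} rs z = trans (sym (*-identityˡ _)) (x≈x+y⇒y≈0 (trans
      (head-cong A rs λ j → sym (trans (+-congˡ (trans (*-identityˡ _) (z j))) (+-identityʳ _)))
      (linear A 1# v v rs)))

    alternating-0 : ∀ m → Alternating {w} m (λ _ → 0#)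
    alternating-0 zero = nil
    alternating-0 (suc m) = cons (λ _ _ → refl)
      (λ a _ _ _ → sym (trans (+-identityˡ _) (zeroʳ a))) (rp m) (λ _ → alternating-0 m)
      where
      rp : ∀ m → VanishesOnRepeat {w} m (λ _ _ → 0#)
      rp zero = Poly.tt
      rp (suc m) _ _ = refl

    alternating-combination : ∀ {m} {f g : Vec (Row w) m → Carrier} a b →
      Alternating m f → Alternating m g → Alternating m (λ rs → a * f rs + b * g rs)
    alternating-combination a b nil nil = nil
    alternating-combination {suc m} {f} {g} a b (cons cg ln rp fx) (cons cg′ ln′ rp′ fx′) = cons
      (λ e rs → +-cong (*-congˡ (cg e rs)) (*-congˡ (cg′ e rs)))
      (λ d v u rs → trans (+-cong (*-congˡ (ln d v u rs)) (*-congˡ (ln′ d v u rs)))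
        (solve 7 (λ a b d x x′ y y′ → a :* (x :+ d :* x′) :+ b :* (y :+ d :* y′) :=
                   (a :* x :+ b :* y) :+ d :* (a :* x′ :+ b :* y′)) refl
           a b d (f (v ∷ rs)) (f (u ∷ rs)) (g (v ∷ rs)) (g (u ∷ rs))))
      (rep m rp rp′)
      (λ v → alternating-combination a b (fx v) (fx′ v))
      where
      rep : ∀ m {f g : Row w → Vec (Row w) m → Carrier} → VanishesOnRepeat m f →
        VanishesOnRepeat m g → VanishesOnRepeat m (λ v rs → a * f v rs + b * g v rs)
      rep zero _ _ = Poly.tt
      rep (suc m) r r′ v rs =
        trans (+-cong (trans (*-congˡ (r v rs)) (zeroʳ a)) (trans (*-congˡ (r′ v rs)) (zeroʳ b)))
              (+-identityˡ _)

    alternating-altSum : ∀ {m} n (a : Fin n → Carrier) (f : Fin n → Vec (Row w) m → Carrier) →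
      (∀ j → Alternating m (f j)) → Alternating m (λ rs → altSum n (λ j → a j * f j rs))
    alternating-altSum zero a f A = alternating-0 _
    alternating-altSum (suc n) a f A = alternating-combination (a fzero) -1# (A fzero)
      (alternating-altSum n (a ∘ fsuc) (f ∘ fsuc) (A ∘ fsuc))

    alternating-columns : ∀ {m w′} {f : Vec (Row w′) m → Carrier} (σ : Fin w′ → Fin w) →
      Alternating m f → Alternating m (λ rs → f (map (_∘ σ) rs))
    alternating-columns σ nil = nil
    alternating-columns {suc m} {w′} {f} σ (cons cg ln rp fx) = cons
      (λ e rs → cg (e ∘ σ) _)
      (λ a v u rs → ln a (v ∘ σ) (u ∘ σ) (map (_∘ σ) rs))
      (rp′ m rp)
      (λ v → alternating-columns σ (fx (v ∘ σ)))
      where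
      rp′ : ∀ m {f : Row w′ → Vec (Row w′) m → Carrier} → VanishesOnRepeat m f →
        VanishesOnRepeat m (λ v rs → f (v ∘ σ) (map (_∘ σ) rs))
      rp′ zero _ = Poly.tt
      rp′ (suc m) r v rs = r (v ∘ σ) (map (_∘ σ) rs)

  determinant : ∀ n → Vec (Row n) n → Carrier
  determinant zero [] = 1#
  determinant (suc n) (v ∷ rs) =
    altSum (suc n) (λ j → v j * determinant n (map (_∘ punchIn j) rs))

  map-∘-cong : ∀ {n w w₁ w₂} {σ : Fin w₁ → Fin w} {ρ : Fin n → Fin w₁} {σ′ : Fin w₂ → Fin w}
    {ρ′ : Fin n → Fin w₂} → (∀ l → σ (ρ l) ≡ σ′ (ρ′ l)) → ∀ {m} (rs : Vec (Row w) m) →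
    Pointwise _≋_ (map (_∘ ρ) (map (_∘ σ) rs)) (map (_∘ ρ′) (map (_∘ σ′) rs))
  map-∘-cong e [] = []
  map-∘-cong e (v ∷ rs) = (λ l → reflexive (≡.cong v (e l))) ∷ map-∘-cong e rs

  determinant-alternating : ∀ n → Alternating n (determinant n)
  determinant-alternating zero = nil
  determinant-alternating (suc n) = cons
    (λ {v} {u} e rs → altSum-cong (suc n) {λ j → v j * minor rs j} λ j → *-congʳ (e j))
    (λ a v u rs → trans
      (altSum-cong (suc n) {λ j → (v +ʳ a *ʳ u) j * minor rs j}
        (λ j → trans (distribʳ _ _ _) (+-congˡ (*-assoc a (u j) (minor rs j)))))
      (altSum-linear (suc n) a (λ j → v j * minor rs j) (λ j → u j * minor rs j)))
    (repeat n (determinant-alternating n))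
    (λ v → alternating-altSum (suc n) v (λ j rs → minor rs j)
             λ j → alternating-columns (punchIn j) (determinant-alternating n))
    where
    minor : Vec (Row (suc n)) n → Fin (suc n) → Carrier
    minor rs j = determinant n (map (_∘ punchIn j) rs)
    -- Expanding along both equal rows gives the terms v j · v j′ times a double minor. These are
    -- symmetric in the two deleted columns, whereas the signs are antisymmetric.
    repeat : ∀ n → Alternating n (determinant n) →
      VanishesOnRepeat n (λ v rs → determinant (suc n) (v ∷ rs))
    repeat zero _ = Poly.tt
    repeat (suc n) (cons _ _ _ fx) v rs = trans
      (altSum-cong (suc (suc n)) λ j → *-distribˡ-altSum (suc n) (v j) λ k → v (punchIn j k) * minor₂ j k)
      (altSum-symmetric≈0 (suc n) (λ j k → v j * (v (punchIn j k) * minor₂ j k)) symmetric)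
      where
      minor₂ : Fin (suc (suc n)) → Fin (suc n) → Carrier
      minor₂ j k = determinant n (map (_∘ punchIn k) (map (_∘ punchIn j) rs))
      symmetric : ∀ j k j′ k′ → punchIn j k ≡ j′ → punchIn j′ k′ ≡ j →
        v j * (v (punchIn j k) * minor₂ j k) ≈ v j′ * (v (punchIn j′ k′) * minor₂ j′ k′)
      symmetric j k j′ k′ ≡.refl e = begin
        v j * (v j′ * minor₂ j k)
          ≈⟨ *-congˡ (*-congˡ (alternating-cong (determinant-alternating n)
               (map-∘-cong (punchIn-swap j k ≡.refl e) rs))) ⟩
        v j * (v j′ * minor₂ j′ k′)
          ≈⟨ solve 3 (λ x y z → x :* (y :* z) := y :* (x :* z)) refl _ _ _ ⟩
        v j′ * (v j * minor₂ j′ k′)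
          ≡⟨ ≡.cong (λ i → v j′ * (v i * minor₂ j′ k′)) e ⟨
        v j′ * (v (punchIn j′ k′) * minor₂ j′ k′) ∎

  altFold : ∀ {n} → (Fin n → Carrier) → List.List (Fin n) → Bool → Carrier
  altFold f List.[] s = 0#
  altFold f (j List.∷ js) true = f j + altFold f js false
  altFold f (j List.∷ js) false = (- f j) + altFold f js true

  sgn : Bool → Carrier
  sgn true = 1#
  sgn false = -1#

  altFold-tabulate : ∀ {n} m (f : Fin n → Carrier) (σ : Fin m → Fin n) s →
    altFold f (List.tabulate σ) s ≈ sgn s * altSum m (f ∘ σ)
  altFold-tabulate zero f σ s = sym (zeroʳ _)
  altFold-tabulate (suc m) f σ true = trans (+-congˡ (altFold-tabulate m f (σ ∘ fsuc) false)) (sym (*-identityˡ _))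
  altFold-tabulate (suc m) f σ false = trans
    (+-cong (sym (-1*x≈-x _)) (trans (altFold-tabulate m f (σ ∘ fsuc) true) (*-identityˡ _)))
    (trans (+-congˡ (sym -1*-1*)) (sym (distribˡ _ _ _)))
    where
    -1*-1* : ∀ {a} → -1# * (-1# * a) ≈ a
    -1*-1* = trans (-1*x≈-x _) (trans (-‿cong (-1*x≈-x _)) (⁻¹-involutive _))

  firstRowTerm : ∀ n → (Fin (suc n) → Fin (suc n) → Carrier) → Fin (suc n) → Carrier
  firstRowTerm n M j = M fzero j * det R n (λ i k → M (fsuc i) (punchIn j k))

  mutual
    det-altFold : ∀ n (M : Fin (suc n) → Fin (suc n) → Carrier) →
      det R (suc n) M ≡ altFold (firstRowTerm n M) (List.allFin (suc n)) true
    -- Generalising the remaining list and the sign leaves the local function applied to variables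
    -- only, so that unification can solve for it.
    det-altFold n M with List.tabulate {n = n} fsuc | false
    ... | js | s = ≡.cong (firstRowTerm n M fzero +_) (go≡altFold n M js s)

    -- The omitted left-hand side is the local function of `det`, found by unification with `det-altFold`.
    go≡altFold : ∀ n (M : Fin (suc n) → Fin (suc n) → Carrier) js s →
      _ ≡ altFold (firstRowTerm n M) js s
    go≡altFold n M List.[] s = ≡.refl
    go≡altFold n M (j List.∷ js) true = ≡.cong (firstRowTerm n M j +_) (go≡altFold n M js false)
    go≡altFold n M (j List.∷ js) false = ≡.cong (- firstRowTerm n M j +_) (go≡altFold n M js true)

  det≈determinant : ∀ n (M : Fin n → Fin n → Carrier) → det R n M ≈ determinant n (tabulate M)
  det≈determinant zero M = refl
  det≈determinant (suc n) M = begin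
    det R (suc n) M ≡⟨ det-altFold n M ⟩
    altFold (firstRowTerm n M) (List.allFin (suc n)) true ≈⟨ altFold-tabulate (suc n) (firstRowTerm n M) (λ j → j) true ⟩
    1# * altSum (suc n) (firstRowTerm n M) ≈⟨ *-identityˡ _ ⟩
    altSum (suc n) (firstRowTerm n M) ≈⟨ altSum-cong (suc n) (λ j → *-congˡ {M fzero j} (trans
      (det≈determinant n (λ i k → M (fsuc i) (punchIn j k)))
      (reflexive (≡.cong (determinant n) (tabulate-∘ (_∘ punchIn j) (M ∘ fsuc)))))) ⟩
    determinant (suc n) (tabulate M) ∎

  -- Branching of determinants

  sumTo : ℕ → (ℕ → Carrier) → Carrier
  sumTo zero f = 0#
  sumTo (suc n) f = sumTo n f + f n

  sumTo-cong : ∀ n {f g} → (∀ m → m < n → f m ≈ g m) → sumTo n f ≈ sumTo n g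
  sumTo-cong zero e = refl
  sumTo-cong (suc n) e = +-cong (sumTo-cong n λ m lt → e m (ℕₚ.m≤n⇒m≤1+n lt)) (e n ℕₚ.≤-refl)

  sumTo-linear : ∀ n a (f g : ℕ → Carrier) →
    sumTo n (λ m → f m + a * g m) ≈ sumTo n f + a * sumTo n g
  sumTo-linear zero a f g = sym (trans (+-identityˡ _) (zeroʳ a))
  sumTo-linear (suc n) a f g = trans (+-congʳ (sumTo-linear n a f g))
    (solve 5 (λ F a G f g → (F :+ a :* G) :+ (f :+ a :* g) := (F :+ f) :+ a :* (G :+ g)) refl
       (sumTo n f) a (sumTo n g) (f n) (g n))

  sumTo-0 : ∀ n → sumTo n (λ _ → 0#) ≈ 0#
  sumTo-0 zero = refl
  sumTo-0 (suc n) = trans (+-identityʳ _) (sumTo-0 n)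

  *-distribˡ-sumTo : ∀ n a (f : ℕ → Carrier) → a * sumTo n f ≈ sumTo n (λ m → a * f m)
  *-distribˡ-sumTo zero a f = zeroʳ a
  *-distribˡ-sumTo (suc n) a f = trans (distribˡ _ _ _) (+-congʳ (*-distribˡ-sumTo n a f))

  -- The sum of φ(μ) over the partitions μ with μ₁ < d contained in λ = ks, weighted by t to the
  -- number of nonempty columns of λ/μ; the rows i in which such a column ends contribute
  -- λᵢ − max(μᵢ, λᵢ₊₁).
  branch : Carrier → ∀ {m} → ℕ → Vec ℕ m → (Vec ℕ m → Carrier) → Carrier
  branch t d [] φ = φ []
  branch t d (k ∷ ks) φ = sumTo d λ m →
    pow R t (k ∸ (m ⊔ firstPart ks)) * branch t (suc (m ⊓ firstPart ks)) ks (φ ∘ (m ∷_))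

  module _ (t : Carrier) where

    -- The bound `suc (m ⊓ firstPart ks)` keeps every part at most the preceding one; `below`
    -- carries this bound along so that each vector reached is known to be a partition.
    branch-cong : ∀ {n} d (ks : Vec ℕ n) {φ ψ} →
      (∀ μ → IsPartition μ → φ μ ≈ ψ μ) → branch t d ks φ ≈ branch t d ks ψ
    branch-cong {zero} d [] e = e [] tt
    branch-cong {suc n} d (k ∷ ks) {φ} {ψ} e = sumTo-cong d λ m _ → *-congˡ (below m ks (λ μ le p → e (m ∷ μ) (cons-partition μ le p)))
      where
      below : ∀ m {n} (ks : Vec ℕ n) {φ ψ} → (∀ μ → firstPart μ ≤ m → IsPartition μ → φ μ ≈ ψ μ) →
        branch t (suc (m ⊓ firstPart ks)) ks φ ≈ branch t (suc (m ⊓ firstPart ks)) ks ψ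
      below m [] e = e [] z≤n tt
      below m (k ∷ ks) e = sumTo-cong _ λ m′ m′< → *-congˡ (below m′ ks λ μ le p →
        e (m′ ∷ μ) (ℕₚ.≤-trans (ℕₚ.≤-pred m′<) (ℕₚ.m⊓n≤m m k)) (cons-partition μ le p))

    branch-linear : ∀ {n} d (ks : Vec ℕ n) a φ ψ →
      branch t d ks (λ μ → φ μ + a * ψ μ) ≈ branch t d ks φ + a * branch t d ks ψ
    branch-linear d [] a φ ψ = refl
    branch-linear d (k ∷ ks) a φ ψ = trans
      (sumTo-cong d λ m _ → trans (*-congˡ (branch-linear (suc (m ⊓ firstPart ks)) ks a (φ ∘ (m ∷_)) (ψ ∘ (m ∷_))))
        (solve 4 (λ c x a y → c :* (x :+ a :* y) := c :* x :+ a :* (c :* y)) refl _ _ a _))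
      (sumTo-linear d a _ _)

    branch-0 : ∀ {n} d (ks : Vec ℕ n) → branch t d ks (λ _ → 0#) ≈ 0#
    branch-0 d [] = refl
    branch-0 d (k ∷ ks) = trans
      (sumTo-cong d λ m _ → trans (*-congˡ (branch-0 (suc (m ⊓ firstPart ks)) ks)) (zeroʳ _)) (sumTo-0 d)

    *-distribˡ-branch : ∀ {n} d (ks : Vec ℕ n) a φ →
      branch t d ks (λ μ → a * φ μ) ≈ a * branch t d ks φ
    *-distribˡ-branch d ks a φ = begin
      branch t d ks (λ μ → a * φ μ) ≈⟨ branch-cong d ks (λ μ _ → sym (+-identityˡ _)) ⟩
      branch t d ks (λ μ → 0# + a * φ μ) ≈⟨ branch-linear d ks a (λ _ → 0#) φ ⟩
      branch t d ks (λ _ → 0#) + a * branch t d ks φ ≈⟨ +-congʳ (branch-0 d ks) ⟩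
      0# + a * branch t d ks φ ≈⟨ +-identityˡ _ ⟩
      a * branch t d ks φ ∎

  -- Since m counts the rows below, `k + m` is the index λᵢ + n - i. The parameter p advances with
  -- the row, as the exponent of 1/(1-z) will.
  rows : ∀ {w} (u : ℕ → ℕ → Row w) → ℕ → ∀ {m} → Vec ℕ m → Vec (Row w) m
  rows u p [] = []
  rows u p {suc m} (k ∷ ks) = u p (k ℕ.+ m) ∷ rows u (suc p) ks

  -- Coefficient form of the statement that the series of level p + 1 is the one of level p divided
  -- by 1 - z.
  PascalRule : ∀ {w} (u : ℕ → ℕ → Row w) → Set ℓ
  PascalRule u = (∀ p → u (suc p) 0 ≋ u p 0) × (∀ p q → u (suc p) (suc q) ≋ u (suc p) q +ʳ u p (suc q))

  module _ {w : ℕ} where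

    module _ {m} {f : Vec (Row w) (suc (suc m)) → Carrier} (A : Alternating (suc (suc m)) f) where

      add-second : ∀ a v u rs → f (v ∷ u +ʳ a *ʳ v ∷ rs) ≈ f (v ∷ u ∷ rs)
      add-second a v u rs = begin
        f (v ∷ u +ʳ a *ʳ v ∷ rs) ≈⟨ linear (fix A v) a u v rs ⟩
        f (v ∷ u ∷ rs) + a * f (v ∷ v ∷ rs) ≈⟨ +-congˡ (trans (*-congˡ (repeat≈0 A v rs)) (zeroʳ a)) ⟩
        f (v ∷ u ∷ rs) + 0# ≈⟨ +-identityʳ _ ⟩
        f (v ∷ u ∷ rs) ∎

      add-first : ∀ a v u rs → f (v +ʳ a *ʳ u ∷ u ∷ rs) ≈ f (v ∷ u ∷ rs)
      add-first a v u rs = begin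
        f (v +ʳ a *ʳ u ∷ u ∷ rs) ≈⟨ linear A a v u (u ∷ rs) ⟩
        f (v ∷ u ∷ rs) + a * f (u ∷ u ∷ rs) ≈⟨ +-congˡ (trans (*-congˡ (repeat≈0 A u rs)) (zeroʳ a)) ⟩
        f (v ∷ u ∷ rs) + 0# ≈⟨ +-identityʳ _ ⟩
        f (v ∷ u ∷ rs) ∎

    scale : ∀ {m} {f : Vec (Row w) (suc m) → Carrier} → Alternating (suc m) f →
      ∀ a v rs → f (a *ʳ v ∷ rs) ≈ a * f (v ∷ rs)
    scale {f = f} A a v rs = begin
      f (a *ʳ v ∷ rs) ≈⟨ head-cong A rs (λ j → sym (+-identityˡ _)) ⟩
      f ((λ _ → 0#) +ʳ a *ʳ v ∷ rs) ≈⟨ linear A a _ v rs ⟩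
      f ((λ _ → 0#) ∷ rs) + a * f (v ∷ rs) ≈⟨ +-congʳ (head-zero A rs λ _ → refl) ⟩
      0# + a * f (v ∷ rs) ≈⟨ +-identityˡ _ ⟩
      a * f (v ∷ rs) ∎

  module _ {w} (t : Carrier) (u U : ℕ → ℕ → Row w) (u-pascal : PascalRule u) (U-pascal : PascalRule U)
    (U-zero : ∀ p → U p 0 ≋ u p 0) (U-suc : ∀ p q → U p (suc q) ≋ u p (suc q) +ʳ t *ʳ U p q)
    where

    -- With U = u/(1-tz), this is the coefficient of z^q in tzU, that is ∑_{i<q} t^{q-i} u p i: the
    -- part of U p q that comes from strictly smaller indices.
    tailSum : ℕ → ℕ → Row w
    tailSum p zero = λ _ → 0#
    tailSum p (suc q) = t *ʳ U p q

    U-split : ∀ p q → U p q ≋ u p q +ʳ 1# *ʳ tailSum p q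
    U-split p zero j = trans (U-zero p j) (sym (trans (+-congˡ (zeroʳ _)) (+-identityʳ _)))
    U-split p (suc q) j = trans (U-suc p q j) (+-congˡ (sym (*-identityˡ _)))

    -- The rows X, W, W′ = X + W and y = W′ - tW lie in one plane, and shears in it do not change f:
    -- (X, W′) → (X, W) → (W′, W) → (y, W). At index zero both sides vanish, by a repeated row and
    -- by a zero row.
    tailSum-exchange : ∀ {m} {f : Vec (Row w) (suc (suc m)) → Carrier} → Alternating (suc (suc m)) f →
      ∀ p q rs → f (t *ʳ U p q ∷ U (suc p) q ∷ rs) ≈ f (u (suc p) q ∷ tailSum (suc p) q ∷ rs)
    tailSum-exchange {f = f} A p zero rs = begin
      f (t *ʳ U p 0 ∷ U (suc p) 0 ∷ rs) ≈⟨ scale A t _ _ ⟩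
      t * f (U p 0 ∷ U (suc p) 0 ∷ rs) ≈⟨ *-congˡ (head-cong A _ λ j → sym (proj₁ U-pascal p j)) ⟩
      t * f (U (suc p) 0 ∷ U (suc p) 0 ∷ rs) ≈⟨ trans (*-congˡ (repeat≈0 A _ rs)) (zeroʳ t) ⟩
      0# ≈⟨ head-zero (fix A _) rs (λ _ → refl) ⟨
      f (u (suc p) zero ∷ tailSum (suc p) zero ∷ rs) ∎
    tailSum-exchange {f = f} A p (suc q) rs = begin
      f (t *ʳ X ∷ W′ ∷ rs) ≈⟨ scale A t X _ ⟩
      t * f (X ∷ W′ ∷ rs) ≈⟨ *-congˡ (head-cong (fix A X) rs W′≋W+X) ⟩
      t * f (X ∷ W +ʳ 1# *ʳ X ∷ rs) ≈⟨ *-congˡ (add-second A 1# X W rs) ⟩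
      t * f (X ∷ W ∷ rs) ≈⟨ *-congˡ (add-first A 1# X W rs) ⟨
      t * f (X +ʳ 1# *ʳ W ∷ W ∷ rs) ≈⟨ *-congˡ (head-cong A (W ∷ rs) W′≋X+W) ⟨
      t * f (W′ ∷ W ∷ rs) ≈⟨ *-congˡ (head-cong A (W ∷ rs) (U-suc (suc p) q)) ⟩
      t * f (y +ʳ t *ʳ W ∷ W ∷ rs) ≈⟨ *-congˡ (add-first A t y W rs) ⟩
      t * f (y ∷ W ∷ rs) ≈⟨ scale (fix A y) t W rs ⟨
      f (y ∷ t *ʳ W ∷ rs) ∎
      where
      X = U p (suc q)
      W = U (suc p) q
      W′ = U (suc p) (suc q)
      y = u (suc p) (suc q)
      W′≋W+X : W′ ≋ W +ʳ 1# *ʳ X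
      W′≋W+X j = trans (proj₂ U-pascal p q j) (+-congˡ (sym (*-identityˡ _)))
      W′≋X+W : W′ ≋ X +ʳ 1# *ʳ W
      W′≋X+W j = trans (proj₂ U-pascal p q j) (trans (+-comm _ _) (+-congˡ (sym (*-identityˡ _))))

    -- Summing the row above a fixed row b over b ≤ a < n telescopes to the difference of the rows n and b
    -- one level down, and the latter is killed by alternation.
    triangle-telescopes : ∀ {m} {f : Vec (Row w) (suc (suc m)) → Carrier} → Alternating (suc (suc m)) f →
      ∀ p k (ks : Vec ℕ m) n →
      sumTo n (λ a → branch t (suc a) (k ∷ ks) (λ μ → f (u p (a ℕ.+ suc m) ∷ rows u (suc p) μ))) ≈
      branch t n (k ∷ ks) (λ μ → f (u (suc p) (n ℕ.+ m) ∷ rows u (suc p) μ))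
    triangle-telescopes A p k ks zero = refl
    triangle-telescopes {m} {f} A p k ks (suc n) = begin
      sumTo n _ + br (suc n) (u p (n ℕ.+ suc m)) ≈⟨ +-congʳ (triangle-telescopes A p k ks n) ⟩
      br n v + br (suc n) (u p (n ℕ.+ suc m)) ≈⟨ +-congʳ (sym extend) ⟩
      br (suc n) v + br (suc n) (u p (n ℕ.+ suc m))
        ≡⟨ ≡.cong (λ i → br (suc n) v + br (suc n) (u p i)) (ℕₚ.+-suc n m) ⟩
      br (suc n) v + br (suc n) v₁ ≈⟨ +-congˡ (sym (*-identityˡ _)) ⟩
      br (suc n) v + 1# * br (suc n) v₁ ≈⟨ branch-linear t (suc n) (k ∷ ks) 1# (λ μ → f (v ∷ rows u (suc p) μ))
              (λ μ → f (v₁ ∷ rows u (suc p) μ)) ⟨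
      branch t (suc n) (k ∷ ks) (λ μ → f (v ∷ rows u (suc p) μ) + 1# * f (v₁ ∷ rows u (suc p) μ))
        ≈⟨ branch-cong t (suc n) (k ∷ ks) (λ μ _ → sym (trans
             (head-cong A _ λ j → trans (proj₂ u-pascal p (n ℕ.+ m) j) (+-congˡ (sym (*-identityˡ _))))
             (linear A 1# v v₁ (rows u (suc p) μ)))) ⟩
      br (suc n) (u (suc p) (suc n ℕ.+ m)) ∎
      where
      br : ℕ → Row w → Carrier
      br d v = branch t d (k ∷ ks) (λ μ → f (v ∷ rows u (suc p) μ))
      v = u (suc p) (n ℕ.+ m)
      v₁ = u p (suc (n ℕ.+ m))
      extend : br (suc n) v ≈ br n v
      extend = trans (+-congˡ (trans (*-congˡ (trans
        (branch-cong t (suc (n ⊓ firstPart ks)) ks λ μ _ → repeat≈0 A v (rows u (suc (suc p)) μ))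
        (branch-0 t (suc (n ⊓ firstPart ks)) ks))) (zeroʳ _))) (+-identityʳ _)

    mutual
      -- The first row splits as U = u + `tailSum`. The summand u accounts for μ₁ = λ₁, where the
      -- remaining rows branch freely, and `tailSum` accounts for μ₁ < λ₁.
      branch-rows : ∀ {m} {f : Vec (Row w) m → Carrier} → Alternating m f →
        ∀ p (ks : Vec ℕ m) → IsPartition ks →
        branch t (suc (firstPart ks)) ks (f ∘ rows u p) ≈ f (rows U p ks)
      branch-rows A p [] _ = refl
      branch-rows {suc m} {f} A p (k ∷ ks) P = begin
        branch t k (k ∷ ks) (f ∘ rows u p) + pow R t (k ∸ (k ⊔ firstPart ks)) *
            branch t (suc (k ⊓ firstPart ks)) ks (λ μ → f (v ∷ rows u (suc p) μ))
          ≈⟨ +-cong (branch-rows-strict A p k ks P) (*-cong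
               (reflexive (≡.cong (pow R t) (≡.trans (≡.cong (k ∸_) (ℕₚ.m≥n⇒m⊔n≡m le)) (ℕₚ.n∸n≡0 k))))
               (trans (reflexive (≡.cong (λ d → branch t (suc d) ks (λ μ → f (v ∷ rows u (suc p) μ)))
                                         (ℕₚ.m≥n⇒m⊓n≡n le)))
                      (branch-rows (fix A v) (suc p) ks P′))) ⟩
        f (tailSum p (k ℕ.+ m) ∷ rs) + 1# * f (v ∷ rs)
          ≈⟨ trans (+-congˡ (*-identityˡ _)) (trans (+-comm _ _) (+-congˡ (sym (*-identityˡ _)))) ⟩
        f (v ∷ rs) + 1# * f (tailSum p (k ℕ.+ m) ∷ rs)
          ≈⟨ linear A 1# v (tailSum p (k ℕ.+ m)) rs ⟨
        f (v +ʳ 1# *ʳ tailSum p (k ℕ.+ m) ∷ rs)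
          ≈⟨ head-cong A rs (U-split p (k ℕ.+ m)) ⟨
        f (U p (k ℕ.+ m) ∷ rs) ∎
        where
        v = u p (k ℕ.+ m)
        rs = rows U (suc p) ks
        le = proj₁ (uncons-partition ks P)
        P′ = proj₂ (uncons-partition ks P)

      -- Induction on the gap λ₁ - λ₂. For μ₁ ≥ λ₂ the first part does not restrict the second, so
      -- each such term branches independently; the base of the induction is the range μ₁ < λ₂.
      branch-rows-strict : ∀ {m} {f : Vec (Row w) (suc m) → Carrier} → Alternating (suc m) f →
        ∀ p k (ks : Vec ℕ m) → IsPartition (k ∷ ks) →
        branch t k (k ∷ ks) (f ∘ rows u p) ≈ f (tailSum p (k ℕ.+ m) ∷ rows U (suc p) ks)
      branch-rows-strict {m} {f} A p k ks P = begin
        branch t k (k ∷ ks) (f ∘ rows u p)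
          ≡⟨ ≡.cong (λ i → sumTo i (λ a → pow R t (i ∸ (a ⊔ firstPart ks)) * X a)) (ℕₚ.m∸n+n≡m le) ⟨
        stage (k ∸ firstPart ks)
          ≈⟨ stages (k ∸ firstPart ks) ⟩
        f (tailSum p (k ∸ firstPart ks ℕ.+ firstPart ks ℕ.+ m) ∷ rs)
          ≡⟨ ≡.cong (λ i → f (tailSum p (i ℕ.+ m) ∷ rs)) (ℕₚ.m∸n+n≡m le) ⟩
        f (tailSum p (k ℕ.+ m) ∷ rs) ∎
        where
        rs = rows U (suc p) ks
        le = proj₁ (uncons-partition ks P)
        P′ = proj₂ (uncons-partition ks P)
        X : ℕ → Carrier
        X a = branch t (suc (a ⊓ firstPart ks)) ks (λ μ → f (u p (a ℕ.+ m) ∷ rows u (suc p) μ))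
        stage : ℕ → Carrier
        stage e = sumTo (e ℕ.+ firstPart ks) (λ a → pow R t (e ℕ.+ firstPart ks ∸ (a ⊔ firstPart ks)) * X a)
        stages : ∀ e → stage e ≈ f (tailSum p (e ℕ.+ firstPart ks ℕ.+ m) ∷ rs)
        stages zero = branch-rows-overlap A p ks P′
        -- Raising the first part from d to d + 1 multiplies every old term by t and adds the term a
        -- = d with weight t; together they form t · U, which is the next `tailSum`.
        stages (suc e) = begin
          sumTo d (λ a → pow R t (suc d ∸ (a ⊔ firstPart ks)) * X a) + pow R t (suc d ∸ (d ⊔ firstPart ks)) * X d
            ≈⟨ +-cong (sumTo-cong d λ a a<d → trans
                 (*-congʳ (reflexive (≡.cong (pow R t)
                   (ℕₚ.+-∸-assoc 1 {d} {a ⊔ firstPart ks} (ℕₚ.⊔-lub (ℕₚ.<⇒≤ a<d) (ℕₚ.m≤n+m _ e))))))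
                 (*-assoc _ _ _))
                 (*-cong (trans (reflexive (≡.cong (pow R t) (≡.trans
                            (≡.cong (suc d ∸_) (ℕₚ.m≥n⇒m⊔n≡m (ℕₚ.m≤n+m _ e))) (ℕₚ.m+n∸n≡m 1 d))))
                          (*-identityʳ t))
                   (trans (reflexive (≡.cong (λ i → branch t (suc i) ks (λ μ → f (v ∷ rows u (suc p) μ)))
                                             (ℕₚ.m≥n⇒m⊓n≡n (ℕₚ.m≤n+m _ e))))
                          (branch-rows (fix A v) (suc p) ks P′))) ⟩
          sumTo d (λ a → t * (pow R t (d ∸ (a ⊔ firstPart ks)) * X a)) + t * f (v ∷ rs)
            ≈⟨ +-congʳ (trans (sym (*-distribˡ-sumTo d t _)) (*-congˡ (stages e))) ⟩
          t * f (tailSum p (d ℕ.+ m) ∷ rs) + t * f (v ∷ rs)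
            ≈⟨ trans (sym (distribˡ _ _ _)) (*-congˡ (trans (+-comm _ _) (+-congˡ (sym (*-identityˡ _))))) ⟩
          t * (f (v ∷ rs) + 1# * f (tailSum p (d ℕ.+ m) ∷ rs))
            ≈⟨ *-congˡ (linear A 1# v (tailSum p (d ℕ.+ m)) rs) ⟨
          t * f (v +ʳ 1# *ʳ tailSum p (d ℕ.+ m) ∷ rs)
            ≈⟨ *-congˡ (head-cong A rs (U-split p (d ℕ.+ m))) ⟨
          t * f (U p (d ℕ.+ m) ∷ rs)
            ≈⟨ scale A t _ rs ⟨
          f (t *ʳ U p (d ℕ.+ m) ∷ rs) ∎
          where
          d = e ℕ.+ firstPart ks
          v = u p (d ℕ.+ m)

      -- The first row has weight t⁰ and only restricts the second part to be at most a. Telescoping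
      -- over a replaces it by one fixed row of the next level, leaving a strict sum over the rows
      -- below; `tailSum-exchange` then restores the levels.
      branch-rows-overlap : ∀ {m} {f : Vec (Row w) (suc m) → Carrier} → Alternating (suc m) f →
        ∀ p (ks : Vec ℕ m) → IsPartition ks →
        sumTo (firstPart ks) (λ a → pow R t (firstPart ks ∸ (a ⊔ firstPart ks)) *
          branch t (suc (a ⊓ firstPart ks)) ks (λ μ → f (u p (a ℕ.+ m) ∷ rows u (suc p) μ)))
        ≈ f (tailSum p (firstPart ks ℕ.+ m) ∷ rows U (suc p) ks)
      branch-rows-overlap A p [] _ = sym (head-zero A [] λ _ → refl)
      branch-rows-overlap {suc m} {f} A p (k ∷ ks) P = begin
        sumTo k (λ a → pow R t (k ∸ (a ⊔ k)) * br (a ⊓ k) a)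
          ≈⟨ sumTo-cong k (λ a a<k → trans (*-cong
               (reflexive (≡.cong (pow R t) (≡.trans (≡.cong (k ∸_) (ℕₚ.m≤n⇒m⊔n≡n (ℕₚ.<⇒≤ a<k))) (ℕₚ.n∸n≡0 k))))
               (reflexive (≡.cong (λ i → br i a) (ℕₚ.m≤n⇒m⊓n≡m (ℕₚ.<⇒≤ a<k)))))
               (*-identityˡ _)) ⟩
        sumTo k (λ a → br a a)
          ≈⟨ triangle-telescopes A p k ks k ⟩
        branch t k (k ∷ ks) (λ μ → f (u (suc p) (k ℕ.+ m) ∷ rows u (suc p) μ))
          ≈⟨ branch-rows-strict (fix A _) (suc p) k ks P ⟩
        f (u (suc p) (k ℕ.+ m) ∷ tailSum (suc p) (k ℕ.+ m) ∷ rows U (suc (suc p)) ks)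
          ≈⟨ tailSum-exchange A p (k ℕ.+ m) (rows U (suc (suc p)) ks) ⟨
        f (tailSum p (suc (k ℕ.+ m)) ∷ rows U (suc p) (k ∷ ks))
          ≡⟨ ≡.cong (λ i → f (tailSum p i ∷ rows U (suc p) (k ∷ ks))) (ℕₚ.+-suc k m) ⟨
        f (tailSum p (k ℕ.+ suc m) ∷ rows U (suc p) (k ∷ ks)) ∎
        where
        br : ℕ → ℕ → Carrier
        br d a = branch t (suc d) (k ∷ ks) (λ μ → f (u p (a ℕ.+ suc m) ∷ rows u (suc p) μ))

  -- Power series entries

  -- A sequence f stands for the formal power series ∑ f(q) zᑫ; `geom a` divides it by 1 − a z
  -- and `lin a` multiplies it by 1 − a z.
  Series : Set c
  Series = ℕ → Carrier

  infix 4 _≃_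
  _≃_ : Series → Series → Set ℓ
  f ≃ g = ∀ q → f q ≈ g q

  one : Series
  one zero = 1#
  one (suc q) = 0#

  geom : Carrier → Series → Series
  geom a f zero = f zero
  geom a f (suc q) = f (suc q) + a * geom a f q

  lin : Carrier → Series → Series
  lin a f zero = f zero
  lin a f (suc q) = f (suc q) + (- a) * f q

  a*x+-a*x≈0 : ∀ a x → a * x + (- a) * x ≈ 0#
  a*x+-a*x≈0 a x = trans (sym (distribʳ x a (- a))) (trans (*-congʳ (-‿inverseʳ a)) (zeroˡ x))

  geom-cong : ∀ a {f g} → f ≃ g → geom a f ≃ geom a g
  geom-cong a e zero = e zero
  geom-cong a e (suc q) = +-cong (e (suc q)) (*-congˡ (geom-cong a e q))

  geom-lin : ∀ a f → geom a (lin a f) ≃ f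
  geom-lin a f zero = refl
  geom-lin a f (suc q) = begin
    f (suc q) + (- a) * f q + a * geom a (lin a f) q ≈⟨ +-congˡ (*-congˡ (geom-lin a f q)) ⟩
    f (suc q) + (- a) * f q + a * f q ≈⟨ +-assoc _ _ _ ⟩
    f (suc q) + ((- a) * f q + a * f q) ≈⟨ +-congˡ (trans (+-comm _ _) (a*x+-a*x≈0 a (f q))) ⟩
    f (suc q) + 0# ≈⟨ +-identityʳ _ ⟩
    f (suc q) ∎

  geom-comm : ∀ a b f → geom a (geom b f) ≃ geom b (geom a f)
  geom-comm a b f zero = refl
  geom-comm a b f (suc zero) =
    solve 4 (λ f₁ f₀ a b → (f₁ :+ b :* f₀) :+ a :* f₀ := (f₁ :+ a :* f₀) :+ b :* f₀) refl (f 1) (f 0) a b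
  geom-comm a b f (suc (suc q)) = begin
    f₂ + b * gb + a * geom a (geom b f) (suc q) ≈⟨ +-congˡ (*-congˡ (geom-comm a b f (suc q))) ⟩
    f₂ + b * gb + a * (ga + b * geom b (geom a f) q)
      ≈⟨ solve 6 (λ f a b x y g → (f :+ b :* y) :+ a :* (x :+ b :* g) := (f :+ a :* x) :+ b :* (y :+ a :* g))
           refl f₂ a b ga gb (geom b (geom a f) q) ⟩
    f₂ + a * ga + b * (gb + a * geom b (geom a f) q)
      ≈⟨ +-congˡ (*-congˡ (+-congˡ (*-congˡ (geom-comm a b f q)))) ⟨
    f₂ + a * ga + b * geom a (geom b f) (suc q) ≈⟨ +-congˡ (*-congˡ (geom-comm a b f (suc q))) ⟩
    f₂ + a * ga + b * geom b (geom a f) (suc q) ∎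
    where
    f₂ = f (suc (suc q))
    ga = geom a f (suc q)
    gb = geom b f (suc q)

  geom-lin-comm : ∀ a b f → geom a (lin b f) ≃ lin b (geom a f)
  geom-lin-comm a b f zero = refl
  geom-lin-comm a b f (suc zero) =
    solve 4 (λ f₁ f₀ a b → (f₁ :+ b :* f₀) :+ a :* f₀ := (f₁ :+ a :* f₀) :+ b :* f₀) refl (f 1) (f 0) a (- b)
  geom-lin-comm a b f (suc (suc q)) = trans (+-congˡ (*-congˡ (geom-lin-comm a b f (suc q))))
    (solve 6 (λ f₂ f₁ a b g₁ g₀ → (f₂ :+ b :* f₁) :+ a :* (g₁ :+ b :* g₀) :=
                                 (f₂ :+ a :* g₁) :+ b :* (f₁ :+ a :* g₀))
       refl (f (suc (suc q))) (f (suc q)) a (- b) (geom a f (suc q)) (geom a f q))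

  geom₁ : ℕ → Series → Series
  geom₁ zero f = f
  geom₁ (suc p) f = geom 1# (geom₁ p f)

  geom₁-geom : ∀ p a f → geom₁ p (geom a f) ≃ geom a (geom₁ p f)
  geom₁-geom zero a f q = refl
  geom₁-geom (suc p) a f q = trans (geom-cong 1# (geom₁-geom p a f) q) (geom-comm 1# a (geom₁ p f) q)

  geom₁-cong : ∀ p {f g} → f ≃ g → geom₁ p f ≃ geom₁ p g
  geom₁-cong zero e = e
  geom₁-cong (suc p) e = geom-cong 1# (geom₁-cong p e)

  coefficients : ∀ {w} → (Fin w → Series) → ℕ → ℕ → Row w
  coefficients S p q j = geom₁ p (S j) q

  coefficients-pascal : ∀ {w} (S : Fin w → Series) → PascalRule (coefficients S)
  coefficients-pascal S = (λ p j → refl) , λ p q j → trans (+-comm _ _) (+-congʳ (*-identityˡ _))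

  seriesDet : ∀ {w} → (Fin w → Series) → Vec ℕ w → Carrier
  seriesDet {w} S ks = determinant w (rows (coefficients S) 0 ks)

  rows-cong : ∀ {w} {u v : ℕ → ℕ → Row w} → (∀ p q → u p q ≋ v p q) →
    ∀ p {m} (ks : Vec ℕ m) → Pointwise _≋_ (rows u p ks) (rows v p ks)
  rows-cong e p [] = []
  rows-cong e p {suc m} (k ∷ ks) = e p (k ℕ.+ m) ∷ rows-cong e (suc p) ks

  seriesDet-cong : ∀ {w} {S T : Fin w → Series} → (∀ j → S j ≃ T j) →
    ∀ ks → seriesDet S ks ≈ seriesDet T ks
  seriesDet-cong {w} e ks = alternating-cong (determinant-alternating w)
    (rows-cong (λ p q j → geom₁-cong p (e j) q) 0 ks)

  -- Division by 1 - tz commutes with division by powers of 1 - z, so every level satisfies the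
  -- recursion that the branching of rows requires.
  seriesDet-branch : ∀ {w} t (S : Fin w → Series) ks → IsPartition ks →
    seriesDet (geom t ∘ S) ks ≈ branch t (suc (firstPart ks)) ks (seriesDet S)
  seriesDet-branch {w} t S ks P = sym (branch-rows t (coefficients S) (coefficients (geom t ∘ S))
    (coefficients-pascal S) (coefficients-pascal (geom t ∘ S))
    (λ p j → geom₁-geom p t (S j) 0)
    (λ p q j → trans (geom₁-geom p t (S j) (suc q)) (+-congˡ (*-congˡ (sym (geom₁-geom p t (S j) q)))))
    (determinant-alternating w) 0 ks P)

  geomAll : ∀ n → (Fin n → Carrier) → Series → Series
  geomAll zero y f = f
  geomAll (suc n) y f = geom (y (fromℕ n)) (geomAll n (y ∘ inject₁) f)

  geomAll-cong : ∀ n y {f g} → f ≃ g → geomAll n y f ≃ geomAll n y g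
  geomAll-cong zero y e = e
  geomAll-cong (suc n) y e = geom-cong (y (fromℕ n)) (geomAll-cong n (y ∘ inject₁) e)

  -- `geomAll` peels off the last variable, as removing the largest letter does, whereas `linAll`
  -- and `cofactor` peel off the first; this reconciles the two orders.
  geomAll-head : ∀ n y f → geomAll (suc n) y f ≃ geomAll n (y ∘ fsuc) (geom (y fzero) f)
  geomAll-head zero y f q = refl
  geomAll-head (suc n) y f = geom-cong (y (fromℕ (suc n))) (geomAll-head n (y ∘ inject₁) f)

  linAll : ∀ n → (Fin n → Carrier) → Series → Series
  linAll zero y f = f
  linAll (suc n) y f = lin (y fzero) (linAll n (y ∘ fsuc) f)

  cofactor : ∀ n → (Fin n → Carrier) → Fin n → Series
  cofactor (suc n) x fzero = linAll n (x ∘ fsuc) one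
  cofactor (suc n) x (fsuc j) = lin (x fzero) (cofactor n (x ∘ fsuc) j)

  geomAll-linAll : ∀ n y a → geomAll n y (geom a (linAll n y one)) ≃ geom a one
  geomAll-linAll zero y a q = refl
  geomAll-linAll (suc n) y a q = begin
    geomAll (suc n) y (geom a (lin y₀ rest)) q
      ≈⟨ geomAll-head n y _ q ⟩
    geomAll n (y ∘ fsuc) (geom y₀ (geom a (lin y₀ rest))) q
      ≈⟨ geomAll-cong n (y ∘ fsuc) (λ q → trans (geom-comm y₀ a (lin y₀ rest) q)
           (geom-cong a (geom-lin y₀ rest) q)) q ⟩
    geomAll n (y ∘ fsuc) (geom a rest) q
      ≈⟨ geomAll-linAll n (y ∘ fsuc) a q ⟩
    geom a one q ∎
    where
    y₀ = y fzero
    rest = linAll n (y ∘ fsuc) one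

  geomAll-cofactor : ∀ n x j → geomAll n x (cofactor n x j) ≃ geom (x j) one
  geomAll-cofactor (suc n) x fzero q =
    trans (geomAll-head n x _ q) (geomAll-linAll n (x ∘ fsuc) (x fzero) q)
  geomAll-cofactor (suc n) x (fsuc j) q = trans (geomAll-head n x _ q)
    (trans (geomAll-cong n (x ∘ fsuc) (geom-lin (x fzero) _) q) (geomAll-cofactor n (x ∘ fsuc) j q))

  VanishesFrom : ℕ → Series → Set ℓ
  VanishesFrom d f = ∀ q → d ≤ q → f q ≈ 0#

  lin-vanishes : ∀ {d} a {f} → VanishesFrom d f → VanishesFrom (suc d) (lin a f)
  lin-vanishes a z (suc q) (s≤s le) = trans
    (+-cong (z (suc q) (ℕₚ.m≤n⇒m≤1+n le)) (trans (*-congˡ (z q le)) (zeroʳ _))) (+-identityˡ _)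

  linAll-vanishes : ∀ n y → VanishesFrom (suc n) (linAll n y one)
  linAll-vanishes zero y (suc q) _ = refl
  linAll-vanishes (suc n) y = lin-vanishes (y fzero) (linAll-vanishes n (y ∘ fsuc))

  cofactor-vanishes : ∀ n x j → VanishesFrom n (cofactor n x j)
  cofactor-vanishes (suc n) x fzero = linAll-vanishes n (x ∘ fsuc)
  cofactor-vanishes (suc n) x (fsuc j) = lin-vanishes (x fzero) (cofactor-vanishes n (x ∘ fsuc) j)

  -- For a polynomial P of degree at most n, the coefficient of zⁿ in P/(1 − a z) is aⁿ P(1/a).
  geom-linAll-top : ∀ n y a → geom a (linAll n y one) n ≈ Prod.foldFin n (λ l → a - y l)
  geom-linAll-top zero y a = refl
  geom-linAll-top (suc n) y a = begin
    geom a (lin b P) (suc n) ≈⟨ geom-lin-comm a b P (suc n) ⟩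
    P (suc n) + a * G + (- b) * G
      ≈⟨ +-congʳ (trans (+-congʳ (linAll-vanishes n (y ∘ fsuc) (suc n) ℕₚ.≤-refl)) (+-identityˡ _)) ⟩
    a * G + (- b) * G ≈⟨ distribʳ _ _ _ ⟨
    (a - b) * G ≈⟨ *-congˡ (geom-linAll-top n (y ∘ fsuc) a) ⟩
    (a - b) * Prod.foldFin n (λ l → a - y (fsuc l)) ∎
    where
    b = y fzero
    P = linAll n (y ∘ fsuc) one
    G = geom a P n

  -- The determinant at the empty shape

  descending : ∀ {w} → (ℕ → Row w) → ∀ m → Vec (Row w) m
  descending u zero = []
  descending u (suc m) = u m ∷ descending u m

  descending-cong : ∀ {w} {u v : ℕ → Row w} → (∀ q → u q ≋ v q) →
    ∀ m → Pointwise _≋_ (descending u m) (descending v m)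
  descending-cong e zero = []
  descending-cong e (suc m) = e m ∷ descending-cong e m

  map-descending : ∀ {w w′} (σ : Fin w′ → Fin w) (u : ℕ → Row w) m →
    map (_∘ σ) (descending u m) ≡ descending (λ q → u q ∘ σ) m
  map-descending σ u zero = ≡.refl
  map-descending σ u (suc m) = ≡.cong (u m ∘ σ ∷_) (map-descending σ u m)

  -- Dividing all columns by 1 - az is a unitriangular row operation: once the rows below have been
  -- replaced, a times the next row is added to the current one.
  descending-geom : ∀ {w} a {u v : ℕ → Row w} → v 0 ≋ u 0 → (∀ q → v (suc q) ≋ u (suc q) +ʳ a *ʳ v q) →
    ∀ m {f} → Alternating m f → f (descending u m) ≈ f (descending v m)
  descending-geom a e₀ e₁ zero A = refl
  descending-geom a e₀ e₁ (suc zero) A = head-cong A [] (λ j → sym (e₀ j))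
  descending-geom a {u} {v} e₀ e₁ (suc (suc m)) {f} A = begin
    f (u (suc m) ∷ descending u (suc m)) ≈⟨ descending-geom a e₀ e₁ (suc m) (fix A (u (suc m))) ⟩
    f (u (suc m) ∷ v m ∷ descending v m) ≈⟨ add-first A a (u (suc m)) (v m) (descending v m) ⟨
    f (u (suc m) +ʳ a *ʳ v m ∷ v m ∷ descending v m) ≈⟨ head-cong A _ (e₁ m) ⟨
    f (v (suc m) ∷ v m ∷ descending v m) ∎

  -- At the empty shape the indices are consecutive, so the factors 1/(1-z) can be stripped by row
  -- operations, one level at a time from the bottom rows upwards.
  rows-empty-shape : ∀ {w} (S : Fin w → Series) p m {f} → Alternating m f →
    f (rows (coefficients S) p (replicate m 0)) ≈ f (descending (coefficients S p) m)
  rows-empty-shape S p zero A = refl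
  rows-empty-shape S p (suc m) {f} A = trans
    (rows-empty-shape S (suc p) m (fix A (coefficients S p m)))
    (sym (descending-geom 1# (λ j → refl) (λ q j → refl) m (fix A (coefficients S p m))))

  -- The filtered products become full products with default factor 1; those ones occupy the
  -- diagonal and everything below it, so the first row and column split off.
  vandermonde-suc : ∀ n (x : Fin (suc n) → Carrier) →
    vandermonde R x ≈ Prod.foldFin n (λ l → x fzero - x (fsuc l)) * vandermonde R (x ∘ fsuc)
  vandermonde-suc n x = trans (expand (suc n) x)
    (*-cong (*-identityˡ _) (trans (Prod.foldFin-cong n λ i → *-identityˡ _) (sym (expand n (x ∘ fsuc)))))
    where
    factor : ∀ {n} → (Fin n → Carrier) → Fin n → Fin n → Carrier
    factor x i j = if does (toℕ i ℕ.<? toℕ j) then x i - x j else 1#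
    expand : ∀ n (x : Fin n → Carrier) →
      vandermonde R x ≈ Prod.foldFin n λ i → Prod.foldFin n (factor x i)
    expand n x = begin
      vandermonde R x
        ≡⟨ ≡.cong Prod.fold (Listₚ.map-id (List.concatMap g (List.allFin n))) ⟨
      Prod.fold (List.map (λ c → c) (List.concatMap g (List.allFin n)))
        ≈⟨ Prod.fold-concatMap (λ c → c) g (List.allFin n) ⟩
      Prod.fold (List.map (λ i → Prod.fold (List.map (λ c → c) (g i))) (List.allFin n))
        ≈⟨ Prod.fold-tabulate n (λ i → i) _ ⟩
      Prod.foldFin n (λ i → Prod.fold (List.map (λ c → c) (g i)))
        ≈⟨ Prod.foldFin-cong n (λ i → trans (reflexive (≡.cong Prod.fold (Listₚ.map-id (g i))))
             (trans (Prod.fold-filter (λ j → toℕ i ℕ.<? toℕ j) (λ j → x i - x j) (List.allFin n))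
                    (Prod.fold-tabulate n (λ j → j) (factor x i)))) ⟩
      Prod.foldFin n (λ i → Prod.foldFin n (factor x i)) ∎
      where
      g : Fin n → List.List Carrier
      g i = List.map (λ j → x i - x j) (List.filter (λ j → toℕ i ℕ.<? toℕ j) (List.allFin n))

  -- Dividing all columns by 1 - x₀z lowers the degree of every column but the first. The top row
  -- then vanishes outside its corner, the corner is ∏ (x₀ - x_l), and its minor is the same
  -- determinant for the remaining variables.
  cofactor-determinant : ∀ n (x : Fin n → Carrier) →
    determinant n (descending (λ q j → cofactor n x j q) n) ≈ vandermonde R x
  cofactor-determinant zero x = refl
  cofactor-determinant (suc n) x = begin
    determinant (suc n) (descending (λ q j → cofactor (suc n) x j q) (suc n))
      ≈⟨ descending-geom x₀ (λ j → refl) (λ q j → refl) (suc n) (determinant-alternating (suc n)) ⟩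
    determinant (suc n) (descending v (suc n))
      ≈⟨ +-cong (*-cong (geom-linAll-top n (x ∘ fsuc) x₀) minor)
           (trans (*-congˡ (altSum-0 n λ j → trans (*-congʳ (trans (reduce n j)
             (cofactor-vanishes n (x ∘ fsuc) j n ℕₚ.≤-refl))) (zeroˡ _))) (zeroʳ _)) ⟩
    Prod.foldFin n (λ l → x₀ - x (fsuc l)) * vandermonde R (x ∘ fsuc) + 0#
      ≈⟨ +-identityʳ _ ⟩
    Prod.foldFin n (λ l → x₀ - x (fsuc l)) * vandermonde R (x ∘ fsuc)
      ≈⟨ vandermonde-suc n x ⟨
    vandermonde R x ∎
    where
    x₀ = x fzero
    v : ℕ → Row (suc n)
    v q j = geom x₀ (cofactor (suc n) x j) q
    reduce : ∀ q j → v q (fsuc j) ≈ cofactor n (x ∘ fsuc) j q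
    reduce q j = geom-lin x₀ (cofactor n (x ∘ fsuc) j) q
    minor : determinant n (map (_∘ punchIn fzero) (descending v n)) ≈ vandermonde R (x ∘ fsuc)
    minor = trans (reflexive (≡.cong (determinant n) (map-descending fsuc v n)))
      (trans (alternating-cong (determinant-alternating n) (descending-cong reduce n))
             (cofactor-determinant n (x ∘ fsuc)))

  seriesDet-empty-shape : ∀ n (x : Fin n → Carrier) →
    seriesDet (cofactor n x) (replicate n 0) ≈ vandermonde R x
  seriesDet-empty-shape n x = trans
    (rows-empty-shape (cofactor n x) 0 n (determinant-alternating n)) (cofactor-determinant n x)

  -- With n variables the first row has index λ₁ + n - 1 ≥ n, above the degree of every cofactor.
  seriesDet-nonempty-shape : ∀ n (x : Fin (suc n) → Carrier) k ks →
    seriesDet (cofactor (suc n) x) (suc k ∷ ks) ≈ 0#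
  seriesDet-nonempty-shape n x k ks = head-zero (determinant-alternating (suc n)) _
    λ j → cofactor-vanishes (suc n) x j (suc (k ℕ.+ n)) (s≤s (ℕₚ.m≤n+m n k))

  -- Complete homogeneous polynomials and the numerator matrix

  *-distribˡ-∑ : ∀ {a} {A : Set a} c (f : A → Carrier) xs →
    c * Sum.fold (List.map f xs) ≈ Sum.fold (List.map (λ i → c * f i) xs)
  *-distribˡ-∑ c f List.[] = zeroʳ c
  *-distribˡ-∑ c f (i List.∷ xs) = trans (distribˡ _ _ _) (+-congˡ (*-distribˡ-∑ c f xs))

  hComplete-geom : ∀ y ys → (λ k → hComplete R k (y List.∷ ys)) ≃ geom y (λ k → hComplete R k ys)
  hComplete-geom y ys zero = trans (+-identityʳ _) (*-identityˡ _)
  hComplete-geom y ys (suc k) = begin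
    Sum.fold (List.map (λ m → pow R y m * hComplete R (suc k ∸ m) ys) (List.upTo (suc (suc k))))
      ≈⟨ Sum.fold-upTo-suc (λ m → pow R y m * hComplete R (suc k ∸ m) ys) (suc k) ⟩
    1# * hComplete R (suc k) ys + Sum.fold (List.map (λ m → y * pow R y m * term m) (List.upTo (suc k)))
      ≈⟨ +-cong (*-identityˡ _) (Sum.fold-cong (λ m → *-assoc y (pow R y m) (term m)) (List.upTo (suc k))) ⟩
    hComplete R (suc k) ys + Sum.fold (List.map (λ m → y * (pow R y m * term m)) (List.upTo (suc k)))
      ≈⟨ +-congˡ (*-distribˡ-∑ y (λ m → pow R y m * term m) (List.upTo (suc k))) ⟨
    hComplete R (suc k) ys + y * Sum.fold (List.map (λ m → pow R y m * term m) (List.upTo (suc k)))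
      ≡⟨ ≡.cong (λ i → hComplete R (suc k) ys + y * i) (hComplete-∷ k) ⟨
    hComplete R (suc k) ys + y * hComplete R k (y List.∷ ys)
      ≈⟨ +-congˡ (*-congˡ (hComplete-geom y ys k)) ⟩
    hComplete R (suc k) ys + y * geom y (λ k → hComplete R k ys) k ∎
    where
    term : ℕ → Carrier
    term m = hComplete R (k ∸ m) ys
    -- `hComplete` matches on the degree before the list, so it unfolds only when k is a
    -- constructor.
    hComplete-∷ : ∀ k → hComplete R k (y List.∷ ys) ≡
      Sum.fold (List.map (λ m → pow R y m * hComplete R (k ∸ m) ys) (List.upTo (suc k)))
    hComplete-∷ zero = ≡.refl
    hComplete-∷ (suc k) = ≡.refl

  hComplete-[] : (λ k → hComplete R k List.[]) ≃ one
  hComplete-[] zero = refl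
  hComplete-[] (suc k) = refl

  hComplete-geom₁ : ∀ p y → (λ k → hComplete R k (List.replicate p 1# List.∷ʳ y)) ≃ geom₁ p (geom y one)
  hComplete-geom₁ zero y q = trans (hComplete-geom y List.[] q) (geom-cong y hComplete-[] q)
  hComplete-geom₁ (suc p) y q = trans (hComplete-geom 1# _ q) (geom-cong 1# (hComplete-geom₁ p y) q)

  tabulate-rows : ∀ {w} (u : ℕ → ℕ → Row w) p {m} (ks : Vec ℕ m) (M : Fin m → Row w) →
    (∀ i → M i ≋ u (p ℕ.+ toℕ i) (lookup ks i ℕ.+ (m ∸ suc (toℕ i)))) →
    Pointwise _≋_ (tabulate M) (rows u p ks)
  tabulate-rows u p [] M e = []
  tabulate-rows u p {suc m} (k ∷ ks) M e =
    (λ j → trans (e fzero j) (reflexive (≡.cong (λ r → u r (k ℕ.+ m) j) (ℕₚ.+-identityʳ p)))) ∷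
    tabulate-rows u (suc p) ks (M ∘ fsuc) λ i j → trans (e (fsuc i) j)
      (reflexive (≡.cong (λ r → u r (lookup ks i ℕ.+ (m ∸ suc (toℕ i))) j) (ℕₚ.+-suc p (toℕ i))))

  det-numMatrix : ∀ n (lam : Vec ℕ n) x →
    det R n (numMatrix R lam x) ≈ seriesDet (λ j → geom (x j) one) lam
  det-numMatrix n lam x = trans (det≈determinant n (numMatrix R lam x))
    (alternating-cong (determinant-alternating n) (tabulate-rows _ 0 lam (numMatrix R lam x)
      λ i j → hComplete-geom₁ (toℕ i) (x j) (lookup lam i ℕ.+ (n ∸ suc (toℕ i)))))

  -- Weights of reverse plane partitions

  ∑ : ∀ {a} {A : Set a} → List.List A → (A → Carrier) → Carrier
  ∑ xs f = Sum.fold (List.map f xs)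

  ⟦_⟧ : Bool → Carrier
  ⟦ b ⟧ = if b then 1# else 0#

  ⟦⟧-∧ : ∀ a b → ⟦ a ∧ b ⟧ ≈ ⟦ a ⟧ * ⟦ b ⟧
  ⟦⟧-∧ true b = sym (*-identityˡ _)
  ⟦⟧-∧ false b = sym (zeroˡ _)

  -- The entry a contributes x a unless it is repeated directly below, so that every letter of a
  -- column is counted once, at its lowest occurrence.
  rowWeight : ∀ {N k k′} → (Fin N → Carrier) → Vec (Fin N) k → Vec (Fin N) k′ → Carrier
  rowWeight x [] _ = 1#
  rowWeight x (a ∷ as) [] = x a * rowWeight x as []
  rowWeight x (a ∷ as) (b ∷ bs) = (if a ==F b then 1# else x a) * rowWeight x as bs

  fillingWeight : ∀ {N} → (Fin N → Carrier) → ∀ {m} (ks : Vec ℕ m) → Rows N (toList ks) → Carrier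
  fillingWeight x [] tt = 1#
  fillingWeight x (k ∷ []) (r , tt) = rowWeight x r []
  fillingWeight x (k ∷ k′ ∷ ks) (r , r′ , rs) = rowWeight x r r′ * fillingWeight x (k′ ∷ ks) (r′ , rs)

  -- A transfer form of the sum over fillings: r is the row directly above `ks`. Its weight is
  -- included, since it depends on the next row, but its own row condition is left to the caller.
  gBelow : ∀ {N} → (Fin N → Carrier) → ∀ {k} → Vec (Fin N) k → ∀ {m} → Vec ℕ m → Carrier
  gBelow x r [] = rowWeight x r []
  gBelow {N} x r (k ∷ ks) =
    ∑ (allVecs N k) λ s → ⟦ rowOK s ⟧ * ⟦ colOK r s ⟧ * rowWeight x r s * gBelow x s ks

  g : ∀ {N} → (Fin N → Carrier) → ∀ {m} → Vec ℕ m → Carrier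
  g x [] = 1#
  g {N} x (k ∷ ks) = ∑ (allVecs N k) λ s → ⟦ rowOK s ⟧ * gBelow x s ks

  module _ {N : ℕ} (x : Fin N → Carrier) where

    letterWeight : Bool → Fin N → Carrier
    letterWeight b a = if b then x a else 1#

    columnWeight : List.List (Fin N) → Carrier
    columnWeight col = Prod.fold (List.map (λ a → letterWeight (any (a ==F_) col) a) (List.allFin N))

    cellWeight : Maybe (Fin N) → Maybe (Fin N) → Carrier
    cellWeight nothing _ = 1#
    cellWeight (just a) nothing = x a
    cellWeight (just a) (just b) = if a ==F b then 1# else x a

    pow-length-filter : ∀ {A : Set} {P : A → Set} (P? : Decidable P) y xs →
      pow R y (List.length (List.filter P? xs)) ≈
      Prod.fold (List.map (λ i → if does (P? i) then y else 1#) xs)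
    pow-length-filter P? y List.[] = refl
    pow-length-filter P? y (i List.∷ xs) with does (P? i)
    ... | true = *-congˡ (pow-length-filter P? y xs)
    ... | false = trans (pow-length-filter P? y xs) (sym (*-identityˡ _))

    -- Each exponent counts columns, so exchanging the product over letters with the one over
    -- columns collects the letters of each column.
    colCount-columns : ∀ ks T →
      Prod.fold (List.map (λ a → pow R (x a) (colCount ks T a)) (List.allFin N)) ≈
      Prod.fold (List.map (columnWeight ∘ column ks T) (List.upTo (List.foldr _⊔_ 0 ks)))
    colCount-columns ks T = trans
      (Prod.fold-cong (λ a → pow-length-filter (λ j → T? (any (a ==F_) (column ks T j))) (x a) js) (List.allFin N))
      (Prod.fold-comm (λ a j → letterWeight (any (a ==F_) (column ks T j)) a) (List.allFin N) js)
      where js = List.upTo (List.foldr _⊔_ 0 ks)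

  singleton-columnWeight : ∀ {N} (x : Fin N → Carrier) b →
    Prod.fold (List.map (λ a → letterWeight x (a ==F b) a) (List.allFin N)) ≈ x b
  singleton-columnWeight {N} x b = trans (Prod.fold-tabulate N (λ a → a) _) (at N x b)
    where
    at : ∀ N (x : Fin N → Carrier) b → Prod.foldFin N (λ a → letterWeight x (a ==F b) a) ≈ x b
    at (suc N) x fzero = trans (*-congˡ (trans
      (Prod.foldFin-cong N {g = λ _ → 1#} λ a → refl) (Prod.foldFin-ε N))) (*-identityʳ _)
    at (suc N) x (fsuc b) = trans (*-identityˡ _) (trans
      (Prod.foldFin-cong N λ a → reflexive (≡.cong (λ i → letterWeight x i (fsuc a)) (==F-suc a b)))
      (at N (x ∘ fsuc) b))
      where
      ≤F-suc : ∀ (a b : Fin N) → (fsuc a ≤F fsuc b) ≡ (a ≤F b)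
      ≤F-suc fzero b = ≡.refl
      ≤F-suc (fsuc a) b = ≡.refl
      ==F-suc : ∀ (a b : Fin N) → (fsuc a ==F fsuc b) ≡ (a ==F b)
      ==F-suc a b = ≡.cong₂ _∧_ (≤F-suc a b) (≤F-suc b a)

  module _ {N : ℕ} (x : Fin N → Carrier) where

    columnWeight-[] : columnWeight x List.[] ≈ 1#
    columnWeight-[] = Prod.fold-ε (List.allFin N)

    -- In an ascending column the letter a occurs further down exactly when it equals the next
    -- entry; otherwise it is smaller than everything below and contributes a new factor.
    columnWeight-∷ : ∀ a col → Ascending (a List.∷ col) →
      columnWeight x (a List.∷ col) ≈ cellWeight x (just a) (List.head col) * columnWeight x col
    columnWeight-∷ a List.[] _ = begin
      columnWeight x (a List.∷ List.[])
        ≈⟨ Prod.fold-cong (λ i → reflexive (≡.cong (λ b → letterWeight x b i) (∨-identityʳ (i ==F a)))) (List.allFin N) ⟩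
      Prod.fold (List.map (λ i → letterWeight x (i ==F a) i) (List.allFin N))
        ≈⟨ singleton-columnWeight x a ⟩
      x a
        ≈⟨ trans (*-congˡ columnWeight-[]) (*-identityʳ _) ⟨
      x a * columnWeight x List.[] ∎
    columnWeight-∷ a (b List.∷ col) (a≤b Linked.∷ asc) with a ==F b in e
    ... | true = trans
      (Prod.fold-cong (λ i → reflexive (≡.cong (λ z → letterWeight x z i) (absorb i))) (List.allFin N))
      (sym (*-identityˡ _))
      where
      absorb : ∀ i → (i ==F a) ∨ ((i ==F b) ∨ any (i ==F_) col) ≡ (i ==F b) ∨ any (i ==F_) col
      absorb i rewrite ==F⇒≡ a b e with i ==F b
      ... | true = ≡.refl
      ... | false = ≡.refl
    ... | false = begin
      columnWeight x (a List.∷ b List.∷ col)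
        ≈⟨ Prod.fold-cong split (List.allFin N) ⟩
      Prod.fold (List.map (λ i → letterWeight x (i ==F a) i * letterWeight x (any (i ==F_) (b List.∷ col)) i) (List.allFin N))
        ≈⟨ Prod.fold-∙ (λ i → letterWeight x (i ==F a) i) _ (List.allFin N) ⟩
      Prod.fold (List.map (λ i → letterWeight x (i ==F a) i) (List.allFin N)) * columnWeight x (b List.∷ col)
        ≈⟨ *-congʳ (singleton-columnWeight x a) ⟩
      x a * columnWeight x (b List.∷ col) ∎
      where
      a<col : All (λ i → (a ==F i) ≡ false) (b List.∷ col)
      a<col = All.map (λ {i} b≤i → <⇒≠F a i (ℕₚ.<-≤-trans (≤∧≠F⇒< a b a≤b e) b≤i))
                (Linked⇒All (λ p q → ℕₚ.≤-trans p q) {v = b} ℕₚ.≤-refl asc)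
      split : ∀ i → letterWeight x ((i ==F a) ∨ any (i ==F_) (b List.∷ col)) i ≈
        letterWeight x (i ==F a) i * letterWeight x (any (i ==F_) (b List.∷ col)) i
      split i with i ==F a in e′
      ... | false = sym (*-identityˡ _)
      ... | true rewrite ==F⇒≡ i a e′ | any-false (a ==F_) a<col = sym (*-identityʳ _)

    columnWeight-column : ∀ {m k} (r : Vec (Fin N) k) (ks : Vec ℕ m) rs → IsPartition (k ∷ ks) →
      isRPP (toList (k ∷ ks)) (r , rs) ≡ true → ∀ j →
      columnWeight x (column (toList (k ∷ ks)) (r , rs) j) ≈
      cellWeight x (lookupV r j) (topEntry ks rs j) * columnWeight x (column (toList ks) rs j)
    columnWeight-column r ks rs P ok j
      with lookupV r j | column-ascending (_ ∷ ks) (r , rs) P ok j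
    ... | nothing | _ = sym (*-identityˡ _)
    ... | just a | asc = trans (columnWeight-∷ a (column (toList ks) rs j) asc)
                               (*-congʳ (reflexive (≡.cong (cellWeight x (just a)) head≡)))
      where
      head≡ : List.head (column (toList ks) rs j) ≡ topEntry ks rs j
      head≡ with topEntry ks rs j in e
      ... | just b = column-just ks rs j e
      ... | nothing rewrite column-nothing ks rs (proj₂ (uncons-partition ks P)) j e = ≡.refl

    cellWeight-row : ∀ {k k′} (r : Vec (Fin N) k) (r′ : Vec (Fin N) k′) n → k ≤ n →
      Prod.fold (List.map (λ j → cellWeight x (lookupV r j) (lookupV r′ j)) (List.upTo n)) ≈ rowWeight x r r′
    cellWeight-row [] r′ n _ = Prod.fold-ε (List.upTo n)
    cellWeight-row (a ∷ r) [] (suc n) (s≤s le) =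
      trans (Prod.fold-upTo-suc _ n) (*-congˡ (cellWeight-row r [] n le))
    cellWeight-row (a ∷ r) (b ∷ r′) (suc n) (s≤s le) =
      trans (Prod.fold-upTo-suc _ n) (*-congˡ (cellWeight-row r r′ n le))

    -- The range n is left free because one range of columns must serve all the shorter rows below;
    -- missing cells have weight 1.
    columns-fillingWeight : ∀ {m} (ks : Vec ℕ m) T → IsPartition ks → isRPP (toList ks) T ≡ true →
      ∀ n → firstPart ks ≤ n →
      Prod.fold (List.map (columnWeight x ∘ column (toList ks) T) (List.upTo n)) ≈ fillingWeight x ks T
    columns-fillingWeight [] tt P ok n le = trans
      (Prod.fold-cong (λ _ → columnWeight-[]) (List.upTo n)) (Prod.fold-ε (List.upTo n))
    columns-fillingWeight (k ∷ ks) (r , rs) P ok n le = trans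
      (Prod.fold-cong (columnWeight-column r ks rs P ok) (List.upTo n))
      (trans (Prod.fold-∙ _ _ (List.upTo n)) (trans
        (*-congˡ (columns-fillingWeight ks rs (proj₂ (uncons-partition ks P)) (isRPP-tail r ks rs ok) n
                    (ℕₚ.≤-trans (proj₁ (uncons-partition ks P)) le)))
        (combine ks rs)))
      where
      combine : ∀ {m} (ks : Vec ℕ m) rs →
        Prod.fold (List.map (λ j → cellWeight x (lookupV r j) (topEntry ks rs j)) (List.upTo n)) *
          fillingWeight x ks rs ≈ fillingWeight x (k ∷ ks) (r , rs)
      combine [] tt = trans (*-identityʳ _) (cellWeight-row r [] n le)
      combine (k′ ∷ ks) (r′ , rs) = *-congʳ (cellWeight-row r r′ n le)

    colCount-fillingWeight : ∀ {m} (ks : Vec ℕ m) T → IsPartition ks → isRPP (toList ks) T ≡ true →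
      Prod.fold (List.map (λ a → pow R (x a) (colCount (toList ks) T a)) (List.allFin N)) ≈ fillingWeight x ks T
    colCount-fillingWeight ks T P ok = trans (colCount-columns x (toList ks) T)
      (columns-fillingWeight ks T P ok _ (firstPart≤max ks))
      where
      firstPart≤max : ∀ {m} (ks : Vec ℕ m) → firstPart ks ≤ List.foldr _⊔_ 0 (toList ks)
      firstPart≤max [] = z≤n
      firstPart≤max (k ∷ ks) = ℕₚ.m≤m⊔n k _

    ∑-allRows-∷ : ∀ {k} {ks : List.List ℕ} (f : Rows N (k List.∷ ks) → Carrier) →
      ∑ (allRows N (k List.∷ ks)) f ≈ ∑ (allVecs N k) λ r → ∑ (allRows N ks) λ rs → f (r , rs)
    ∑-allRows-∷ {k} {ks} f = trans
      (Sum.fold-concatMap f (λ r → List.map (r ,_) (allRows N ks)) (allVecs N k))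
      (Sum.fold-cong (λ r → Sum.fold-map f (r ,_) (allRows N ks)) (allVecs N k))

    ∑-gBelow : ∀ {m k} (r : Vec (Fin N) k) (ks : Vec ℕ m) →
      ∑ (allRows N (toList ks)) (λ rs →
        ⟦ isRPP (toList (k ∷ ks)) (r , rs) ⟧ * fillingWeight x (k ∷ ks) (r , rs)) ≈
      ⟦ rowOK r ⟧ * gBelow x r ks
    ∑-gBelow r [] = +-identityʳ _
    ∑-gBelow {k = k} r (k′ ∷ ks) = begin
      ∑ (allRows N (toList (k′ ∷ ks))) (λ rs →
        ⟦ isRPP (toList (k ∷ k′ ∷ ks)) (r , rs) ⟧ * fillingWeight x (k ∷ k′ ∷ ks) (r , rs))
        ≈⟨ ∑-allRows-∷ {k = k′} {ks = toList ks} (λ rs →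
             ⟦ isRPP (toList (k ∷ k′ ∷ ks)) (r , rs) ⟧ * fillingWeight x (k ∷ k′ ∷ ks) (r , rs)) ⟩
      ∑ (allVecs N k′) (λ s → ∑ (allRows N (toList ks)) λ rs →
        ⟦ rowOK r ∧ colOK r s ∧ isRPP (toList (k′ ∷ ks)) (s , rs) ⟧ *
          (rowWeight x r s * fillingWeight x (k′ ∷ ks) (s , rs)))
        ≈⟨ Sum.fold-cong (λ s → trans (Sum.fold-cong (λ rs → trans
             (*-congʳ (trans (⟦⟧-∧ _ _) (*-congˡ (⟦⟧-∧ (colOK r s) _))))
             (solve 5 (λ a b c d e → (a :* (b :* c)) :* (d :* e) := (a :* (b :* d)) :* (c :* e)) refl _ _ _ _ _))
             (allRows N (toList ks)))
             (sym (*-distribˡ-∑ (⟦ rowOK r ⟧ * (⟦ colOK r s ⟧ * rowWeight x r s)) _ (allRows N (toList ks)))))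
             (allVecs N k′) ⟩
      ∑ (allVecs N k′) (λ s → ⟦ rowOK r ⟧ * (⟦ colOK r s ⟧ * rowWeight x r s) *
        ∑ (allRows N (toList ks)) (λ rs →
          ⟦ isRPP (toList (k′ ∷ ks)) (s , rs) ⟧ * fillingWeight x (k′ ∷ ks) (s , rs)))
        ≈⟨ Sum.fold-cong (λ s → trans (*-congˡ (∑-gBelow s ks))
             (solve 5 (λ a b c d e → (a :* (b :* c)) :* (d :* e) := a :* (((d :* b) :* c) :* e)) refl _ _ _ _ _))
             (allVecs N k′) ⟩
      ∑ (allVecs N k′) (λ s → ⟦ rowOK r ⟧ *
        (⟦ rowOK s ⟧ * ⟦ colOK r s ⟧ * rowWeight x r s * gBelow x s ks))
        ≈⟨ *-distribˡ-∑ ⟦ rowOK r ⟧ _ (allVecs N k′) ⟨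
      ⟦ rowOK r ⟧ * gBelow x r (k′ ∷ ks) ∎

    ∑-g : ∀ {m} (ks : Vec ℕ m) →
      ∑ (allRows N (toList ks)) (λ T → ⟦ isRPP (toList ks) T ⟧ * fillingWeight x ks T) ≈ g x ks
    ∑-g [] = trans (+-identityʳ _) (*-identityˡ _)
    ∑-g (k ∷ ks) = trans
      (∑-allRows-∷ {k = k} {ks = toList ks} (λ T → ⟦ isRPP (toList (k ∷ ks)) T ⟧ * fillingWeight x (k ∷ ks) T))
      (Sum.fold-cong (λ r → ∑-gBelow r ks) (allVecs N k))

  gPoly≈g : ∀ {n} (lam : Vec ℕ n) x → IsPartition lam → gPoly R lam x ≈ g x lam
  gPoly≈g {n} lam x P = trans
    (Sum.fold-filter (λ T → T? (isRPP (toList lam) T)) _ (allRows n (toList lam)))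
    (trans (Sum.fold-cong guard (allRows n (toList lam))) (∑-g x lam))
    where
    guard : ∀ T → (if isRPP (toList lam) T
        then Prod.fold (List.map (λ a → pow R (x a) (colCount (toList lam) T a)) (List.allFin n)) else 0#) ≈
      ⟦ isRPP (toList lam) T ⟧ * fillingWeight x lam T
    guard T with isRPP (toList lam) T in ok
    ... | true = trans (colCount-fillingWeight x lam T P ok) (sym (*-identityˡ _))
    ... | false = sym (zeroˡ _)

  -- Branching of dual Grothendieck polynomials

  sumTo-head : ∀ n f → sumTo (suc n) f ≈ f 0 + sumTo n (f ∘ suc)
  sumTo-head zero f = +-comm _ _
  sumTo-head (suc n) f = trans (+-congʳ (sumTo-head n f)) (+-assoc _ _ _)

  sumTo-truncate : ∀ {n n′} f → n′ ≤ n → (∀ m → n′ ≤ m → m < n → f m ≈ 0#) → sumTo n f ≈ sumTo n′ f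
  sumTo-truncate f le z = go f (ℕₚ.≤⇒≤′ le) z
    where
    go : ∀ {n n′} f → n′ ℕ.≤′ n → (∀ m → n′ ≤ m → m < n → f m ≈ 0#) → sumTo n f ≈ sumTo n′ f
    go f (ℕ.≤′-reflexive ≡.refl) z = refl
    go f (ℕ.≤′-step {n} le) z = trans (+-cong (go f le λ m p q → z m p (ℕₚ.m≤n⇒m≤1+n q))
                                    (z n (ℕₚ.≤′⇒≤ le) ℕₚ.≤-refl)) (+-identityʳ _)

  foldFin-sumTo : ∀ n m (f : Fin n → ℕ → Carrier) →
    Sum.foldFin n (λ a → sumTo m (f a)) ≈ sumTo m (λ i → Sum.foldFin n (λ a → f a i))
  foldFin-sumTo zero m f = sym (sumTo-0 m)
  foldFin-sumTo (suc n) m f = begin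
    sumTo m (f fzero) + Sum.foldFin n (λ a → sumTo m (f (fsuc a)))
      ≈⟨ +-congˡ (trans (foldFin-sumTo n m (f ∘ fsuc)) (sym (*-identityˡ _))) ⟩
    sumTo m (f fzero) + 1# * sumTo m rest
      ≈⟨ sumTo-linear m 1# (f fzero) rest ⟨
    sumTo m (λ i → f fzero i + 1# * rest i)
      ≈⟨ sumTo-cong m (λ i _ → +-congˡ (*-identityˡ _)) ⟩
    sumTo m (λ i → f fzero i + rest i) ∎
    where
    rest : ℕ → Carrier
    rest i = Sum.foldFin n (λ a → f (fsuc a) i)

  ∑-allVecs-suc : ∀ N k (f : Vec (Fin N) (suc k) → Carrier) →
    ∑ (allVecs N (suc k)) f ≈ Sum.foldFin N (λ a → ∑ (allVecs N k) (λ s → f (a ∷ s)))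
  ∑-allVecs-suc N k f = trans
    (Sum.fold-concatMap f (λ a → List.map (a ∷_) (allVecs N k)) (List.allFin N))
    (trans (Sum.fold-tabulate N (λ a → a) _)
           (Sum.foldFin-cong N λ a → Sum.fold-map f (a ∷_) (allVecs N k)))

  ∑-rows-∷ : ∀ N k (f : Vec (Fin N) (suc k) → Carrier) →
    ∑ (allVecs N (suc k)) (λ s → ⟦ rowOK s ⟧ * f s) ≈
    Sum.foldFin N (λ a → ∑ (allVecs N k) (λ s → ⟦ rowOK s ⟧ * (⟦ headOK a s ⟧ * f (a ∷ s))))
  ∑-rows-∷ N k f = trans (∑-allVecs-suc N k _) (Sum.foldFin-cong N λ a → Sum.fold-cong
    (λ s → trans (*-congʳ (trans (reflexive (≡.cong ⟦_⟧ (rowOK-∷ a s)))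
                                 (trans (⟦⟧-∧ (headOK a s) (rowOK s)) (*-comm _ _))))
                 (*-assoc _ _ _))
    (allVecs N k))

  -- A weakly increasing row is determined by its prefix of small letters, and any weakly increasing
  -- prefix of length m ≤ k occurs. The induction sorts rows by whether the first entry is the
  -- largest letter.
  ∑-rows-padMax : ∀ N k (f : Vec (Fin (suc N)) k → Carrier) →
    ∑ (allVecs (suc N) k) (λ r → ⟦ rowOK r ⟧ * f r) ≈
    sumTo (suc k) (λ m → ∑ (allVecs N m) (λ s → ⟦ rowOK s ⟧ * f (padMax k s)))
  ∑-rows-padMax N zero f = sym (+-identityˡ _)
  ∑-rows-padMax N (suc k) f = begin
    ∑ (allVecs (suc N) (suc k)) (λ r → ⟦ rowOK r ⟧ * f r)
      ≈⟨ ∑-rows-∷ (suc N) k f ⟩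
    Sum.foldFin (suc N) (λ a → ∑ (allVecs (suc N) k) (λ r → ⟦ rowOK r ⟧ * (⟦ headOK a r ⟧ * f (a ∷ r))))
      ≈⟨ Sum.foldFin-cong (suc N) (λ a → ∑-rows-padMax N k (λ r → ⟦ headOK a r ⟧ * f (a ∷ r))) ⟩
    Sum.foldFin (suc N) (λ a → sumTo (suc k) (term a))
      ≈⟨ Sum.foldFin-last N (λ a → sumTo (suc k) (term a)) ⟩
    Sum.foldFin N (λ a → sumTo (suc k) (term (inject₁ a))) + sumTo (suc k) (term (fromℕ N))
      ≈⟨ +-cong smaller largest ⟩
    sumTo (suc k) (λ m → split (suc m)) + split 0
      ≈⟨ +-comm _ _ ⟩
    split 0 + sumTo (suc k) (λ m → split (suc m))
      ≈⟨ sumTo-head (suc k) split ⟨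
    sumTo (suc (suc k)) split ∎
    where
    term : Fin (suc N) → ℕ → Carrier
    term a m = ∑ (allVecs N m) (λ s → ⟦ rowOK s ⟧ * (⟦ headOK a (padMax k s) ⟧ * f (a ∷ padMax k s)))
    split : ℕ → Carrier
    split m = ∑ (allVecs N m) (λ s → ⟦ rowOK s ⟧ * f (padMax (suc k) s))
    smaller : Sum.foldFin N (λ a → sumTo (suc k) (term (inject₁ a))) ≈ sumTo (suc k) (λ m → split (suc m))
    smaller = begin
      Sum.foldFin N (λ a → sumTo (suc k) (term (inject₁ a)))
        ≈⟨ foldFin-sumTo N (suc k) (term ∘ inject₁) ⟩
      sumTo (suc k) (λ m → Sum.foldFin N (λ a → term (inject₁ a) m))
        ≈⟨ sumTo-cong (suc k) (λ m m≤k → trans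
             (Sum.foldFin-cong N λ a → Sum.fold-cong (λ s → *-congˡ (*-congʳ
               (reflexive (≡.cong ⟦_⟧ (headOK-padMax-inject₁ k a s (ℕₚ.≤-pred m≤k)))))) (allVecs N m))
             (sym (∑-rows-∷ N m (λ s → f (padMax (suc k) s))))) ⟩
      sumTo (suc k) (λ m → split (suc m)) ∎
    largest : sumTo (suc k) (term (fromℕ N)) ≈ split 0
    largest = begin
      sumTo (suc k) (term (fromℕ N))
        -- After a largest first entry no small letter can follow, so only the empty prefix
        -- survives.
        ≈⟨ sumTo-truncate {n′ = 1} (term (fromℕ N)) (s≤s z≤n) (λ { (suc m) _ (s≤s m<k) → trans
             (Sum.fold-cong (λ s → trans (*-congˡ (trans (*-congʳ (reflexive (≡.cong ⟦_⟧ (headOK-max k s m<k)))) (zeroˡ _))) (zeroʳ _))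
               (allVecs N (suc m)))
             (Sum.fold-ε (allVecs N (suc m))) }) ⟩
      0# + term (fromℕ N) 0
        ≈⟨ +-identityˡ _ ⟩
      term (fromℕ N) 0
        ≈⟨ +-congʳ (*-congˡ (trans (*-congʳ (reflexive (≡.cong ⟦_⟧ (headOK-max-[] k)))) (*-identityˡ _))) ⟩
      split 0 ∎
      where
      headOK-max-[] : ∀ k → headOK (fromℕ N) (padMax {N} k []) ≡ true
      headOK-max-[] zero = ≡.refl
      headOK-max-[] (suc k) = ≤⇒≤F (fromℕ N) (fromℕ N) ℕₚ.≤-refl
      headOK-max : ∀ {m} k (s : Vec (Fin N) (suc m)) → m < k → headOK (fromℕ N) (padMax k s) ≡ false
      headOK-max (suc k) (b ∷ s) _ = <⇒≰F (inject₁ b) (fromℕ N) (inject₁<fromℕ b)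

  module _ {N : ℕ} (x : Fin (suc N) → Carrier) where

    private
      t : Carrier
      t = x (fromℕ N)
      x↓ : Fin N → Carrier
      x↓ = x ∘ inject₁

    -- A largest letter with a cell below it has another largest letter there, as m′ ≤ m, and weighs
    -- 1. The k ∸ (m ⊔ k′) largest letters with nothing below give t each. A small letter above a
    -- largest one weighs the same as above an empty cell.
    rowWeight-padMax : ∀ {m m′} k k′ (s : Vec (Fin N) m) (s′ : Vec (Fin N) m′) →
      m ≤ k → m′ ≤ k′ → m′ ≤ m → k′ ≤ k →
      rowWeight x (padMax k s) (padMax k′ s′) ≈ pow R t (k ∸ (m ⊔ k′)) * rowWeight x↓ s s′
    rowWeight-padMax zero zero [] [] _ _ _ _ = sym (*-identityˡ _)
    rowWeight-padMax (suc k) zero [] [] _ _ _ _ =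
      trans (*-congˡ (rowWeight-padMax k zero [] [] z≤n z≤n z≤n z≤n)) (sym (*-assoc _ _ _))
    rowWeight-padMax (suc k) (suc k′) [] [] _ _ _ (s≤s q)
      rewrite ==F-refl (fromℕ N) = trans (*-identityˡ _) (rowWeight-padMax k k′ [] [] z≤n z≤n z≤n q)
    rowWeight-padMax {suc m} (suc k) zero (a ∷ s) [] (s≤s le) _ _ _ = trans
      (*-congˡ (rowWeight-padMax k zero s [] le z≤n z≤n z≤n))
      (trans (*-congˡ (*-congʳ (reflexive (≡.cong (λ i → pow R t (k ∸ i)) (ℕₚ.⊔-identityʳ m)))))
        (solve 3 (λ a b c → a :* (b :* c) := b :* (a :* c)) refl _ _ _))
    rowWeight-padMax (suc k) (suc k′) (a ∷ s) [] (s≤s le) _ _ (s≤s q)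
      rewrite <⇒≠F (inject₁ a) (fromℕ N) (inject₁<fromℕ a) = trans
      (*-congˡ (rowWeight-padMax k k′ s [] le z≤n z≤n q))
      (solve 3 (λ a b c → a :* (b :* c) := b :* (a :* c)) refl _ _ _)
    rowWeight-padMax (suc k) (suc k′) (a ∷ s) (b ∷ s′) (s≤s le) (s≤s le′) (s≤s le″) (s≤s q)
      rewrite inject₁-≤F a b | inject₁-≤F b a = trans
      (*-congˡ (rowWeight-padMax k k′ s s′ le le′ le″ q))
      (solve 3 (λ a b c → a :* (b :* c) := b :* (a :* c)) refl _ _ _)

    -- Branching is a finite linear combination of evaluations, so sums over the small rows pass
    -- through it.
    branch-∑ : ∀ {a} {A : Set a} {m} d (ks : Vec ℕ m) (c : A → Carrier) (φ : A → Vec ℕ m → Carrier) xs →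
      branch t d ks (λ μ → ∑ xs (λ s → c s * φ s μ)) ≈ ∑ xs (λ s → c s * branch t d ks (φ s))
    branch-∑ d ks c φ List.[] = branch-0 t d ks
    branch-∑ d ks c φ (s List.∷ xs) = begin
      branch t d ks (λ μ → c s * φ s μ + ∑ xs (λ s → c s * φ s μ))
        ≈⟨ branch-cong t d ks (λ μ _ → +-comm _ _) ⟩
      branch t d ks (λ μ → ∑ xs (λ s → c s * φ s μ) + c s * φ s μ)
        ≈⟨ branch-linear t d ks (c s) (λ μ → ∑ xs (λ s → c s * φ s μ)) (φ s) ⟩
      branch t d ks (λ μ → ∑ xs (λ s → c s * φ s μ)) + c s * branch t d ks (φ s)
        ≈⟨ trans (+-congʳ (branch-∑ d ks c φ xs)) (+-comm _ _) ⟩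
      c s * branch t d ks (φ s) + ∑ xs (λ s → c s * branch t d ks (φ s)) ∎

    -- The prefix lengths of small letters are the parts of μ. The power of t in front belongs to
    -- the upper row alone, and the column condition supplies the bound on the next part.
    gBelow-branch : ∀ {n m k} (s : Vec (Fin N) m) (ks : Vec ℕ n) → m ≤ k → IsPartition (k ∷ ks) →
      gBelow x (padMax k s) ks ≈
      pow R t (k ∸ (m ⊔ firstPart ks)) * branch t (suc (m ⊓ firstPart ks)) ks (gBelow x↓ s)
    gBelow-branch {k = k} s [] m≤k P = rowWeight-padMax k 0 s [] m≤k z≤n z≤n z≤n
    gBelow-branch {m = m} {k = k} s (k′ ∷ ks) m≤k (k′≤k , P) = begin
      ∑ (allVecs (suc N) k′) (λ r → ⟦ rowOK r ⟧ * ⟦ colOK s⁺ r ⟧ * rowWeight x s⁺ r * gBelow x r ks)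
        ≈⟨ Sum.fold-cong (λ r → trans (*-assoc _ _ _) (*-assoc _ _ _)) (allVecs (suc N) k′) ⟩
      ∑ (allVecs (suc N) k′) (λ r → ⟦ rowOK r ⟧ * rest r)
        ≈⟨ ∑-rows-padMax N k′ rest ⟩
      sumTo (suc k′) term
        -- A prefix longer than m would put a small letter under a largest one.
        ≈⟨ sumTo-truncate term (s≤s (ℕₚ.m⊓n≤n m k′)) vanish ⟩
      sumTo (suc (m ⊓ k′)) term
        ≈⟨ sumTo-cong (suc (m ⊓ k′)) (λ m′ m′< → evaluate m′
             (ℕₚ.≤-trans (ℕₚ.≤-pred m′<) (ℕₚ.m⊓n≤m m k′)) (ℕₚ.≤-trans (ℕₚ.≤-pred m′<) (ℕₚ.m⊓n≤n m k′))) ⟩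
      sumTo (suc (m ⊓ k′)) (λ m′ → T₁ * (T₂ m′ * branch t (D m′) ks (λ μ → gBelow x↓ s (m′ ∷ μ))))
        ≈⟨ *-distribˡ-sumTo (suc (m ⊓ k′)) T₁ _ ⟨
      T₁ * branch t (suc (m ⊓ k′)) (k′ ∷ ks) (gBelow x↓ s) ∎
      where
      s⁺ = padMax k s
      T₁ = pow R t (k ∸ (m ⊔ k′))
      T₂ : ℕ → Carrier
      T₂ m′ = pow R t (k′ ∸ (m′ ⊔ firstPart ks))
      D : ℕ → ℕ
      D m′ = suc (m′ ⊓ firstPart ks)
      rest : Vec (Fin (suc N)) k′ → Carrier
      rest r = ⟦ colOK s⁺ r ⟧ * (rowWeight x s⁺ r * gBelow x r ks)
      term : ℕ → Carrier
      term m′ = ∑ (allVecs N m′) (λ s′ → ⟦ rowOK s′ ⟧ * rest (padMax k′ s′))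
      vanish : ∀ m′ → suc (m ⊓ k′) ≤ m′ → m′ < suc k′ → term m′ ≈ 0#
      vanish m′ lo (s≤s m′≤k′) = trans
        (Sum.fold-cong (λ s′ → trans (*-congˡ (trans (*-congʳ (reflexive (≡.cong ⟦_⟧
            (colOK-padMax-false k k′ s s′ m<m′ m′≤k′ k′≤k)))) (zeroˡ _))) (zeroʳ _)) (allVecs N m′))
        (Sum.fold-ε (allVecs N m′))
        where
        m<m′ : m < m′
        m<m′ with m ℕ.≤? k′
        ... | yes m≤k′ = ≡.subst (_< m′) (ℕₚ.m≤n⇒m⊓n≡m m≤k′) lo
        ... | no m≰k′ = contradiction
          (ℕₚ.<-≤-trans (≡.subst (_< m′) (ℕₚ.m≥n⇒m⊓n≡n (ℕₚ.<⇒≤ (ℕₚ.≰⇒> m≰k′))) lo) m′≤k′) (ℕₚ.<-irrefl ≡.refl)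
      evaluate : ∀ m′ → m′ ≤ m → m′ ≤ k′ →
        term m′ ≈ T₁ * (T₂ m′ * branch t (D m′) ks (λ μ → gBelow x↓ s (m′ ∷ μ)))
      evaluate m′ m′≤m m′≤k′ = begin
        term m′
          ≈⟨ Sum.fold-cong (λ s′ → trans (*-congˡ (*-cong
               (reflexive (≡.cong ⟦_⟧ (colOK-padMax k k′ s s′ m≤k m′≤k′ m′≤m)))
               (*-cong (rowWeight-padMax k k′ s s′ m≤k m′≤k′ m′≤m k′≤k) (gBelow-branch s′ ks m′≤k′ P))))
               (solve 6 (λ a b t₁ w t₂ B → a :* (b :* ((t₁ :* w) :* (t₂ :* B))) :=
                                           (t₁ :* t₂) :* (((a :* b) :* w) :* B)) refl _ _ _ _ _ _))
               (allVecs N m′) ⟩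
        ∑ (allVecs N m′) (λ s′ → T₁ * T₂ m′ * (weight s′ * branch t (D m′) ks (gBelow x↓ s′)))
          ≈⟨ *-distribˡ-∑ (T₁ * T₂ m′) _ (allVecs N m′) ⟨
        T₁ * T₂ m′ * ∑ (allVecs N m′) (λ s′ → weight s′ * branch t (D m′) ks (gBelow x↓ s′))
          ≈⟨ *-assoc _ _ _ ⟩
        T₁ * (T₂ m′ * ∑ (allVecs N m′) (λ s′ → weight s′ * branch t (D m′) ks (gBelow x↓ s′)))
          ≈⟨ *-congˡ (*-congˡ (branch-∑ (D m′) ks weight (λ s′ → gBelow x↓ s′) (allVecs N m′))) ⟨
        T₁ * (T₂ m′ * branch t (D m′) ks (λ μ → gBelow x↓ s (m′ ∷ μ))) ∎
        where
        weight : Vec (Fin N) m′ → Carrier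
        weight s′ = ⟦ rowOK s′ ⟧ * ⟦ colOK s s′ ⟧ * rowWeight x↓ s s′

    g-branch : ∀ {n} (ks : Vec ℕ n) → IsPartition ks →
      g x ks ≈ branch t (suc (firstPart ks)) ks (g x↓)
    g-branch [] P = refl
    g-branch (k ∷ ks) P = begin
      ∑ (allVecs (suc N) k) (λ r → ⟦ rowOK r ⟧ * gBelow x r ks)
        ≈⟨ ∑-rows-padMax N k (λ r → gBelow x r ks) ⟩
      sumTo (suc k) (λ m → ∑ (allVecs N m) (λ s → ⟦ rowOK s ⟧ * gBelow x (padMax k s) ks))
        ≈⟨ sumTo-cong (suc k) (λ m m< → evaluate m (ℕₚ.≤-pred m<)) ⟩
      branch t (suc k) (k ∷ ks) (g x↓) ∎
      where
      evaluate : ∀ m → m ≤ k →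
        ∑ (allVecs N m) (λ s → ⟦ rowOK s ⟧ * gBelow x (padMax k s) ks) ≈
        pow R t (k ∸ (m ⊔ firstPart ks)) *
          branch t (suc (m ⊓ firstPart ks)) ks (λ μ → g x↓ (m ∷ μ))
      evaluate m m≤k = begin
        ∑ (allVecs N m) (λ s → ⟦ rowOK s ⟧ * gBelow x (padMax k s) ks)
          ≈⟨ Sum.fold-cong (λ s → trans (*-congˡ (gBelow-branch s ks m≤k P))
               (solve 3 (λ a b c → a :* (b :* c) := b :* (a :* c)) refl _ _ _)) (allVecs N m) ⟩
        ∑ (allVecs N m) (λ s → T₁ * (⟦ rowOK s ⟧ * branch t D ks (gBelow x↓ s)))
          ≈⟨ *-distribˡ-∑ T₁ _ (allVecs N m) ⟨
        T₁ * ∑ (allVecs N m) (λ s → ⟦ rowOK s ⟧ * branch t D ks (gBelow x↓ s))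
          ≈⟨ *-congˡ (branch-∑ D ks (λ s → ⟦ rowOK s ⟧) (λ s → gBelow x↓ s) (allVecs N m)) ⟨
        T₁ * branch t D ks (λ μ → g x↓ (m ∷ μ)) ∎
        where
        T₁ = pow R t (k ∸ (m ⊔ firstPart ks))
        D = suc (m ⊓ firstPart ks)

  -- Induction on the number of letters

  g-replicate-0 : ∀ {N} (x : Fin N → Carrier) n → g x (replicate n 0) ≈ 1#
  g-replicate-0 x zero = refl
  g-replicate-0 x (suc n) = trans (+-identityʳ _) (trans (*-identityˡ _) (below n))
    where
    below : ∀ n → gBelow x [] (replicate n 0) ≈ 1#
    below zero = refl
    below (suc n) = trans (+-identityʳ _) (trans
      (*-congʳ (trans (*-identityʳ _) (*-identityʳ _))) (trans (*-identityˡ _) (below n)))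

  -- Both sides branch by the same rule when a letter is added. Keeping x fixed makes the
  -- Vandermonde product a scalar that passes through the branching, and λ must vary because the
  -- hypothesis is used at every μ.
  g-vandermonde : ∀ {n} (x : Fin n → Carrier) N (y : Fin N → Carrier) (lam : Vec ℕ n) → IsPartition lam →
    g y lam * vandermonde R x ≈ seriesDet (geomAll N y ∘ cofactor n x) lam
  g-vandermonde x zero y [] P = trans (*-identityˡ _) (sym (seriesDet-empty-shape 0 x))
  g-vandermonde x zero y (suc k ∷ ks) P = trans (zeroˡ _) (sym (seriesDet-nonempty-shape _ x k ks))
  g-vandermonde {n} x zero y (zero ∷ ks) P
    rewrite partition-zero ks P =
      trans (*-congʳ (g-replicate-0 y n)) (trans (*-identityˡ _) (sym (seriesDet-empty-shape n x)))
  g-vandermonde {n} x (suc N) y lam P = begin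
    g y lam * vandermonde R x
      ≈⟨ *-congʳ (g-branch y lam P) ⟩
    branch t d lam (g (y ∘ inject₁)) * vandermonde R x
      ≈⟨ trans (*-comm _ _) (sym (*-distribˡ-branch t d lam (vandermonde R x) (g (y ∘ inject₁)))) ⟩
    branch t d lam (λ μ → vandermonde R x * g (y ∘ inject₁) μ)
      ≈⟨ branch-cong t d lam (λ μ Pμ → trans (*-comm _ _) (g-vandermonde x N (y ∘ inject₁) μ Pμ)) ⟩
    branch t d lam (seriesDet (geomAll N (y ∘ inject₁) ∘ cofactor n x))
      ≈⟨ seriesDet-branch t (geomAll N (y ∘ inject₁) ∘ cofactor n x) lam P ⟨
    seriesDet (geomAll (suc N) y ∘ cofactor n x) lam ∎
    where
    t = y (fromℕ N)
    d = suc (firstPart lam)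

theorem5p1 : {c ℓ : Level} (R : CommutativeRing c ℓ) (n : ℕ) (lam : Vec ℕ n) →
    IsPartition lam → (x : Fin n → CommutativeRing.Carrier R) →
    CommutativeRing._≈_ R
    (CommutativeRing._*_ R (gPoly R lam x) (vandermonde R x))
    (det R n (numMatrix R lam x))
theorem5p1 R n lam P x = begin
  gPoly R lam x * vandermonde R x ≈⟨ *-congʳ (gPoly≈g lam x P) ⟩
  g x lam * vandermonde R x ≈⟨ g-vandermonde x n x lam P ⟩
  seriesDet (geomAll n x ∘ cofactor n x) lam ≈⟨ seriesDet-cong (geomAll-cofactor n x) lam ⟩
  seriesDet (λ j → geom (x j) one) lam ≈⟨ det-numMatrix n lam x ⟨
  det R n (numMatrix R lam x) ∎
  where
  open CommutativeRing R hiding (zero)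
  open import Relation.Binary.Reasoning.Setoid setoid
  open DualGrothendieck R
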